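{- Let $p$ be a prime, let $g$ be the genus of $Y_0(p)$, let $V_p=H_1(Y_0(p),\mathbb{R})\cong\mathbb{R}^{2g+1}$, and let $B=\{v_0,\dots,v_{2g}\}$ be a basis of $V_p$. Let $$\mathcal{L}(x_0,\dots,x_n)=\left\{\sum_{0\leq i\leq n}a_{ik}x_i+\sum_{0\leq j\leq2g}b_{jk}v_j=0\right\}_{0\leq k\leq K}$$ be a system of linear equations in $V_p$ (in the variables $x_0,\dots,x_n$) satisfying: (1) $\mathcal{L}$ has exactly one solution $(x_0,\dots,x_n)\in (V_p)^{n+1}$; (2) for any subset $A\subset\{0,\dots,K\}$, any $0\leq i\leq n$ and any $0\leq j\leq2g$, we have $\sum_{k\in A}a_{ik}\in\{ -1,0,1\}$ and $\sum_{k\in A}b_{jk}\in\{ -1,0,1\}$. Then the unique solution $(x_0,\dots,x_n)\in (V_p)^{n+1}$ satisfies $$x_i=\sum_{0\leq j\leq2g}c_{ij}v_j,\qquad c_{ij}\in\{ -1,0,1\},$$ for all $0\leq i\leq n$.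
   Context: $\Gamma_0(p)\leq\mathrm{PSL}_2(\mathbb{Z})$ is the image of the matrices with lower left entry divisible by $p$, acting on the upper half-plane $\mathbb{H}$, and $Y_0(p)=\Gamma_0(p)\backslash\mathbb{H}$ is the (non-compact) modular curve of prime level $p$; its first real homology $V_p$ has dimension $2g+1$. In the paper's setup the basis $B$ consists of homology classes of side pairing transformations of a fundamental polygon of $\Gamma_0(p)$ (under $\gamma\mapsto$ class of the geodesic from $z$ to $\gamma z$). -}

module Defs where

open import Algebra.Bundles using (CommutativeMonoid; CommutativeRing)
open import Algebra.Module.Bundles using (Module)
open import Algebra.Module.Structures.Biased using (IsModuleFromLeft)
open import Algebra.Consequences.Setoid using (comm∧idˡ⇒id; comm∧distrˡ⇒distr)
import Algebra.Solver.Ring.NaturalCoefficients.Default as SemiringSolver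
open import Algebra.Structures using (IsAbelianGroup)
import Algebra.Properties.Semiring.Exp as SemiringExp
import Algebra.Properties.AbelianGroup as AbelianGroupProperties
import Algebra.Properties.CommutativeMonoid.Sum as CommutativeMonoidSum
import Algebra.Properties.CommutativeSemigroup as CommutativeSemigroupProperties
import Algebra.Properties.Ring as RingProperties
open import Data.Bool.Base using (if_then_else_)
open import Data.Empty using (⊥)
open import Data.Fin.Base using (Fin; zero; suc; toℕ)
open import Data.Fin.Subset using (Subset)
open import Data.Integer.Base as ℤ using (ℤ; 0ℤ; 1ℤ)
open import Data.Integer.Coprimality using (Coprime)
import Data.Integer.Divisibility.Signed as ℤ∣
import Data.Integer.Properties as ℤ
import Data.Integer.Solver as ℤSolver
open import Data.Nat.Base as ℕ using (ℕ; zero; suc)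
import Data.Nat.Properties as ℕ
open import Data.Product.Base using (Σ; ∃; ∃-syntax; _×_; _,_; proj₁; proj₂)
open import Data.Rational.Base as ℚ using (ℚ; 0ℚ; 1ℚ; ½; ∣_∣)
import Data.Rational.Properties as ℚ
import Data.Rational.Solver as ℚSolver
open import Data.Rational.Unnormalised.Base as ℚᵘ using (mkℚᵘ; *≡*)
import Data.Rational.Unnormalised.Properties as ℚᵘ
open import Data.Sum.Base using (_⊎_; inj₁; inj₂)
open import Data.Sum.Relation.Binary.Pointwise using (_⊎ₛ_; inj₁; inj₂)
open import Data.Unit.Base using (⊤; tt)
open import Data.Vec.Base using (lookup)
open import Data.Vec.Functional using (Vector; insertAt; removeAt)
open import Data.Vec.Functional.Properties using (insertAt-lookup; removeAt-insertAt)
open import Function.Base using (_∘_)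
open import Level using (0ℓ; _⊔_) renaming (suc to lsuc)
open import Relation.Binary.Bundles using (Setoid)
open import Relation.Binary.Core using (Rel)
open import Relation.Binary.Definitions using (_Respects_)
open import Relation.Binary.PropositionalEquality using (_≡_; refl; sym; trans; cong; cong₂; subst; subst₂)
open import Relation.Binary.Structures using (IsEquivalence)
import Relation.Binary.Reasoning.Setoid as SetoidReasoning
open import Relation.Nullary.Negation using (¬_)
open import Relation.Unary using (Pred; _∩_; ⋃; _≐_; _⊆_)

Eventually : Pred ℕ 0ℓ → Set
Eventually P = ∃[ N ] ∀ n → N ℕ.≤ n → P n

-- Cauchy sequences of rationals, taken modulo null sequences by _≈_.
record ℝ : Set where
  no-eta-equality
  field
    seq    : ℕ → ℚ
    cauchy : ∀ ε → 0ℚ ℚ.< ε → ∃[ N ] ∀ m n → N ℕ.≤ m → N ℕ.≤ n → ∣ seq m ℚ.- seq n ∣ ℚ.< ε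

open ℝ public

infix 4 _≈_ _<_ _≤_

record _≈_ (x y : ℝ) : Set where
  no-eta-equality
  constructor mk≈
  field
    close : ∀ ε → 0ℚ ℚ.< ε → Eventually λ n → ∣ seq x n ℚ.- seq y n ∣ ℚ.< ε

record _<_ (x y : ℝ) : Set where
  no-eta-equality
  pattern
  constructor mk<
  field
    gap     : ℚ
    gap>0   : 0ℚ ℚ.< gap
    bounded : Eventually λ n → seq x n ℚ.+ gap ℚ.< seq y n

_≤_ : ℝ → ℝ → Set
x ≤ y = ¬ (y < x)

open _≈_ public
open _<_ public

private
  module ℚS = ℚSolver.+-*-Solver

  both : ∀ {P Q R : Pred ℕ 0ℓ} → (∀ {n} → P n → Q n → R n) →
         Eventually P → Eventually Q → Eventually R
  both f (M , p) (N , q) =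
    M ℕ.⊔ N , λ n le → f (p n (ℕ.m⊔n≤o⇒m≤o M N le)) (q n (ℕ.m⊔n≤o⇒n≤o M N le))

  ½-pos : ∀ {ε} → 0ℚ ℚ.< ε → 0ℚ ℚ.< ½ ℚ.* ε
  ½-pos {ε} 0<ε = subst (ℚ._< ½ ℚ.* ε) (ℚ.*-zeroʳ ½) (ℚ.*-monoʳ-<-pos ½ 0<ε)

  ½+½ : ∀ ε → ½ ℚ.* ε ℚ.+ ½ ℚ.* ε ≡ ε
  ½+½ ε = trans (sym (ℚ.*-distribʳ-+ ε ½ ½)) (ℚ.*-identityˡ ε)

  tri : ∀ {ε} p q {r} → r ≡ p ℚ.+ q → ∣ p ∣ ℚ.< ½ ℚ.* ε → ∣ q ∣ ℚ.< ½ ℚ.* ε → ∣ r ∣ ℚ.< ε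
  tri {ε} p q refl p< q< =
    ℚ.≤-<-trans (ℚ.∣p+q∣≤∣p∣+∣q∣ p q) (subst (∣ p ∣ ℚ.+ ∣ q ∣ ℚ.<_) (½+½ ε) (ℚ.+-mono-< p< q<))

  flip∣-∣ : ∀ p q → ∣ p ℚ.- q ∣ ≡ ∣ q ℚ.- p ∣
  flip∣-∣ p q = trans (sym (ℚ.∣-p∣≡∣p∣ (p ℚ.- q)))
    (cong ∣_∣ (ℚS.solve 2 (λ p q → ℚS.:- (p ℚS.:- q) ℚS.:= q ℚS.:- p) refl p q))

  self∣-∣ : ∀ p → ∣ p ℚ.- p ∣ ≡ 0ℚ
  self∣-∣ p = cong ∣_∣ (ℚ.+-inverseʳ p)

  telescope : ∀ p q r → p ℚ.- r ≡ (p ℚ.- q) ℚ.+ (q ℚ.- r)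
  telescope = ℚS.solve 3 (λ p q r → p ℚS.:- r ℚS.:= (p ℚS.:- q) ℚS.:+ (q ℚS.:- r)) refl

  +-diff : ∀ p q r s → (p ℚ.+ q) ℚ.- (r ℚ.+ s) ≡ (p ℚ.- r) ℚ.+ (q ℚ.- s)
  +-diff = ℚS.solve 4 (λ p q r s →
    (p ℚS.:+ q) ℚS.:- (r ℚS.:+ s) ℚS.:= (p ℚS.:- r) ℚS.:+ (q ℚS.:- s)) refl

  *-diff : ∀ p q r s → (p ℚ.* q) ℚ.- (r ℚ.* s) ≡ p ℚ.* (q ℚ.- s) ℚ.+ s ℚ.* (p ℚ.- r)
  *-diff = ℚS.solve 4 (λ p q r s →
    (p ℚS.:* q) ℚS.:- (r ℚS.:* s) ℚS.:= p ℚS.:* (q ℚS.:- s) ℚS.:+ s ℚS.:* (p ℚS.:- r)) refl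

  neg-diff : ∀ p q → ∣ (ℚ.- p) ℚ.- (ℚ.- q) ∣ ≡ ∣ p ℚ.- q ∣
  neg-diff p q = trans
    (cong ∣_∣ (ℚS.solve 2 (λ p q → (ℚS.:- p) ℚS.:- (ℚS.:- q) ℚS.:= q ℚS.:- p) refl p q))
    (flip∣-∣ q p)

  ∣*∣< : ∀ p q {A δ} → 0ℚ ℚ.< A → ∣ p ∣ ℚ.≤ A → ∣ q ∣ ℚ.< δ → ∣ p ℚ.* q ∣ ℚ.< A ℚ.* δ
  ∣*∣< p q {A} {δ} 0<A p≤A q<δ = subst (ℚ._< A ℚ.* δ) (sym (ℚ.∣p*q∣≡∣p∣*∣q∣ p q))
    (ℚ.≤-<-trans (ℚ.*-monoʳ-≤-nonNeg ∣ q ∣ {{ℚ.∣-∣-nonNeg q}} p≤A)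
                 (ℚ.*-monoʳ-<-pos A {{ℚ.positive 0<A}} q<δ))

  mulBound : ∀ p q r s {A B δ} → 0ℚ ℚ.< A → 0ℚ ℚ.< B → ∣ p ∣ ℚ.≤ A → ∣ s ∣ ℚ.≤ B →
             ∣ p ℚ.- r ∣ ℚ.< δ → ∣ q ℚ.- s ∣ ℚ.< δ →
             ∣ p ℚ.* q ℚ.- r ℚ.* s ∣ ℚ.< (A ℚ.+ B) ℚ.* δ
  mulBound p q r s {A} {B} {δ} 0<A 0<B p≤A s≤B pr qs =
    subst₂ ℚ._<_ (cong ∣_∣ (sym (*-diff p q r s))) (sym (ℚ.*-distribʳ-+ δ A B))
      (ℚ.≤-<-trans (ℚ.∣p+q∣≤∣p∣+∣q∣ (p ℚ.* (q ℚ.- s)) (s ℚ.* (p ℚ.- r)))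
        (ℚ.+-mono-< (∣*∣< p (q ℚ.- s) 0<A p≤A qs) (∣*∣< s (p ℚ.- r) 0<B s≤B pr)))

  divide : ∀ {C ε} → 0ℚ ℚ.< C → 0ℚ ℚ.< ε → ∃[ δ ] 0ℚ ℚ.< δ × C ℚ.* δ ≡ ε
  divide {C} {ε} 0<C 0<ε = 1/C ℚ.* ε ,
      ℚ.positive⁻¹ _ {{ℚ.pos*pos⇒pos 1/C {{ℚ.1/pos⇒pos C}} ε {{ℚ.positive 0<ε}}}} ,
      trans (sym (ℚ.*-assoc C 1/C ε))
            (trans (cong (ℚ._* ε) (ℚ.*-inverseʳ C)) (ℚ.*-identityˡ ε))
    where
    instance
      C-pos : ℚ.Positive C
      C-pos = ℚ.positive 0<C
      C-nonZero : ℚ.NonZero C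
      C-nonZero = ℚ.pos⇒nonZero C
    1/C : ℚ
    1/C = ℚ.1/ C

  0<1 : 0ℚ ℚ.< 1ℚ
  0<1 = ℚ.positive⁻¹ 1ℚ

  bound : (x : ℝ) → ∃[ A ] 0ℚ ℚ.< A × Eventually λ n → ∣ seq x n ∣ ℚ.≤ A
  bound x with cauchy x 1ℚ 0<1
  ... | N , h = 1ℚ ℚ.+ ∣ seq x N ∣ ,
      ℚ.+-mono-<-≤ 0<1 (ℚ.0≤∣p∣ (seq x N)) ,
      N , λ n N≤n → ℚ.≤-trans
        (ℚ.≤-reflexive (cong ∣_∣ (ℚS.solve 2 (λ p q → p ℚS.:= (p ℚS.:- q) ℚS.:+ q) refl (seq x n) (seq x N))))
        (ℚ.≤-trans (ℚ.∣p+q∣≤∣p∣+∣q∣ (seq x n ℚ.- seq x N) (seq x N))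
          (ℚ.+-monoˡ-≤ ∣ seq x N ∣ (ℚ.<⇒≤ (h n N N≤n ℕ.≤-refl))))

infixl 6 _+_ _-_
infixl 7 _*_
infix  8 -_

fromℚ : ℚ → ℝ
fromℚ q .seq _ = q
fromℚ q .cauchy ε 0<ε = 0 , λ _ _ _ _ → subst (ℚ._< ε) (sym (self∣-∣ q)) 0<ε

0ℝ 1ℝ : ℝ
0ℝ = fromℚ 0ℚ
1ℝ = fromℚ 1ℚ

_+_ : ℝ → ℝ → ℝ
(x + y) .seq n = seq x n ℚ.+ seq y n
(x + y) .cauchy ε 0<ε with cauchy x (½ ℚ.* ε) (½-pos 0<ε) | cauchy y (½ ℚ.* ε) (½-pos 0<ε)
... | M , f | N , g = M ℕ.⊔ N , λ m n hm hn →
  tri (seq x m ℚ.- seq x n) (seq y m ℚ.- seq y n)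
    (+-diff (seq x m) (seq y m) (seq x n) (seq y n))
    (f m n (ℕ.m⊔n≤o⇒m≤o M N hm) (ℕ.m⊔n≤o⇒m≤o M N hn))
    (g m n (ℕ.m⊔n≤o⇒n≤o M N hm) (ℕ.m⊔n≤o⇒n≤o M N hn))

-_ : ℝ → ℝ
(- x) .seq n = ℚ.- seq x n
(- x) .cauchy ε 0<ε with cauchy x ε 0<ε
... | N , f = N , λ m n hm hn →
  subst (ℚ._< ε) (sym (neg-diff (seq x m) (seq x n))) (f m n hm hn)

_-_ : ℝ → ℝ → ℝ
x - y = x + - y

_*_ : ℝ → ℝ → ℝ
(x * y) .seq n = seq x n ℚ.* seq y n
(x * y) .cauchy ε 0<ε =
  let A , 0<A , K , f = bound x
      B , 0<B , L , g = bound y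
      δ , 0<δ , eq    = divide (ℚ.+-mono-< 0<A 0<B) 0<ε
      M , h           = cauchy x δ 0<δ
      N , k           = cauchy y δ 0<δ
  in (K ℕ.⊔ L) ℕ.⊔ (M ℕ.⊔ N) , λ m n hm hn →
    let hm₁ = ℕ.m⊔n≤o⇒m≤o (K ℕ.⊔ L) (M ℕ.⊔ N) hm
        hm₂ = ℕ.m⊔n≤o⇒n≤o (K ℕ.⊔ L) (M ℕ.⊔ N) hm
        hn₁ = ℕ.m⊔n≤o⇒m≤o (K ℕ.⊔ L) (M ℕ.⊔ N) hn
        hn₂ = ℕ.m⊔n≤o⇒n≤o (K ℕ.⊔ L) (M ℕ.⊔ N) hn
    in subst (∣ seq x m ℚ.* seq y m ℚ.- seq x n ℚ.* seq y n ∣ ℚ.<_) eq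
      (mulBound (seq x m) (seq y m) (seq x n) (seq y n) 0<A 0<B
        (f m (ℕ.m⊔n≤o⇒m≤o K L hm₁))
        (g n (ℕ.m⊔n≤o⇒n≤o K L hn₁))
        (h m n (ℕ.m⊔n≤o⇒m≤o M N hm₂) (ℕ.m⊔n≤o⇒m≤o M N hn₂))
        (k m n (ℕ.m⊔n≤o⇒n≤o M N hm₂) (ℕ.m⊔n≤o⇒n≤o M N hn₂)))

pointwise⇒≈ : ∀ {x y} → (∀ n → seq x n ≡ seq y n) → x ≈ y
pointwise⇒≈ {x} {y} eq .close ε 0<ε = 0 , λ n _ →
  subst (ℚ._< ε) (sym (trans (cong (λ q → ∣ q ℚ.- seq y n ∣) (eq n)) (self∣-∣ (seq y n)))) 0<ε

≈-isEquivalence : IsEquivalence _≈_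
≈-isEquivalence = record
  { refl  = pointwise⇒≈ λ _ → refl
  ; sym   = λ {x} {y} x≈y → mk≈ λ ε 0<ε → let N , f = close x≈y ε 0<ε in
      N , λ n N≤n → subst (ℚ._< ε) (flip∣-∣ (seq x n) (seq y n)) (f n N≤n)
  ; trans = λ {x} {y} {z} x≈y y≈z → mk≈ λ ε 0<ε →
      both (λ {n} → tri (seq x n ℚ.- seq y n) (seq y n ℚ.- seq z n)
                        (telescope (seq x n) (seq y n) (seq z n)))
           (close x≈y _ (½-pos 0<ε)) (close y≈z _ (½-pos 0<ε))
  }

private
  +-cong : ∀ {x y u v} → x ≈ y → u ≈ v → x + u ≈ y + v
  +-cong {x} {y} {u} {v} x≈y u≈v .close ε 0<ε =
    both (λ {n} → tri (seq x n ℚ.- seq y n) (seq u n ℚ.- seq v n)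
                      (+-diff (seq x n) (seq u n) (seq y n) (seq v n)))
         (close x≈y _ (½-pos 0<ε)) (close u≈v _ (½-pos 0<ε))

  -‿cong : ∀ {x y} → x ≈ y → - x ≈ - y
  -‿cong {x} {y} x≈y .close ε 0<ε with close x≈y ε 0<ε
  ... | N , f = N , λ n N≤n →
    subst (ℚ._< ε) (sym (neg-diff (seq x n) (seq y n))) (f n N≤n)

  *-cong : ∀ {x y u v} → x ≈ y → u ≈ v → x * u ≈ y * v
  *-cong {x} {y} {u} {v} x≈y u≈v .close ε 0<ε =
    let A , 0<A , f  = bound x
        B , 0<B , g  = bound v
        δ , 0<δ , eq = divide (ℚ.+-mono-< 0<A 0<B) 0<ε
    in both (λ {n} (a , b) (c , d) →
              subst (∣ seq x n ℚ.* seq u n ℚ.- seq y n ℚ.* seq v n ∣ ℚ.<_) eq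
                (mulBound (seq x n) (seq u n) (seq y n) (seq v n) 0<A 0<B a b c d))
            (both _,_ f g)
            (both _,_ (close x≈y δ 0<δ) (close u≈v δ 0<δ))

  +-assoc : ∀ x y z → (x + y) + z ≈ x + (y + z)
  +-assoc x y z = pointwise⇒≈ λ n → ℚ.+-assoc (seq x n) (seq y n) (seq z n)

  +-comm : ∀ x y → x + y ≈ y + x
  +-comm x y = pointwise⇒≈ λ n → ℚ.+-comm (seq x n) (seq y n)

  +-identityˡ : ∀ x → 0ℝ + x ≈ x
  +-identityˡ x = pointwise⇒≈ λ n → ℚ.+-identityˡ (seq x n)

  +-identityʳ : ∀ x → x + 0ℝ ≈ x
  +-identityʳ x = pointwise⇒≈ λ n → ℚ.+-identityʳ (seq x n)

  +-inverseˡ : ∀ x → - x + x ≈ 0ℝ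
  +-inverseˡ x = pointwise⇒≈ λ n → ℚ.+-inverseˡ (seq x n)

  +-inverseʳ : ∀ x → x + - x ≈ 0ℝ
  +-inverseʳ x = pointwise⇒≈ λ n → ℚ.+-inverseʳ (seq x n)

  *-assoc : ∀ x y z → (x * y) * z ≈ x * (y * z)
  *-assoc x y z = pointwise⇒≈ λ n → ℚ.*-assoc (seq x n) (seq y n) (seq z n)

  *-comm : ∀ x y → x * y ≈ y * x
  *-comm x y = pointwise⇒≈ λ n → ℚ.*-comm (seq x n) (seq y n)

  *-identityˡ : ∀ x → 1ℝ * x ≈ x
  *-identityˡ x = pointwise⇒≈ λ n → ℚ.*-identityˡ (seq x n)

  *-identityʳ : ∀ x → x * 1ℝ ≈ x
  *-identityʳ x = pointwise⇒≈ λ n → ℚ.*-identityʳ (seq x n)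

  *-distribˡ-+ : ∀ x y z → x * (y + z) ≈ x * y + x * z
  *-distribˡ-+ x y z = pointwise⇒≈ λ n → ℚ.*-distribˡ-+ (seq x n) (seq y n) (seq z n)

  *-distribʳ-+ : ∀ x y z → (y + z) * x ≈ y * x + z * x
  *-distribʳ-+ x y z = pointwise⇒≈ λ n → ℚ.*-distribʳ-+ (seq x n) (seq y n) (seq z n)

ℝ-commutativeRing : CommutativeRing 0ℓ 0ℓ
ℝ-commutativeRing = record
  { Carrier = ℝ
  ; _≈_ = _≈_
  ; _+_ = _+_
  ; _*_ = _*_
  ; -_  = -_
  ; 0#  = 0ℝ
  ; 1#  = 1ℝ
  ; isCommutativeRing = record
    { isRing = record
      { +-isAbelianGroup = record
        { isGroup = record
          { isMonoid = record
            { isSemigroup = record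
              { isMagma = record { isEquivalence = ≈-isEquivalence ; ∙-cong = +-cong }
              ; assoc = +-assoc
              }
            ; identity = +-identityˡ , +-identityʳ
            }
          ; inverse = +-inverseˡ , +-inverseʳ
          ; ⁻¹-cong = -‿cong
          }
        ; comm = +-comm
        }
      ; *-cong = *-cong
      ; *-assoc = *-assoc
      ; *-identity = *-identityˡ , *-identityʳ
      ; distrib = *-distribˡ-+ , *-distribʳ-+
      }
    ; *-comm = *-comm
    }
  }

module ℝR = CommutativeRing ℝ-commutativeRing
module ℝΣ = CommutativeMonoidSum ℝR.+-commutativeMonoid

fromℤ : ℤ → ℝ
fromℤ i = fromℚ (i ℚ./ 1)

-- ∣ x - y ∣ < ε
Near : ℚ → ℝ → ℝ → Set
Near ε x y = (x - y < fromℚ ε) × (y - x < fromℚ ε)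

private
  <-fromℚ-mono : ∀ {x ε δ} → ε ℚ.≤ δ → x < fromℚ ε → x < fromℚ δ
  <-fromℚ-mono ε≤δ (mk< η 0<η (N , f)) = mk< η 0<η (N , λ n N≤n → ℚ.<-≤-trans (f n N≤n) ε≤δ)

  Near-mono : ∀ {x y ε δ} → ε ℚ.≤ δ → Near ε x y → Near δ x y
  Near-mono ε≤δ (p , q) = <-fromℚ-mono ε≤δ p , <-fromℚ-mono ε≤δ q

  const-< : ∀ {p q} → p ℚ.< q → fromℚ p < fromℚ q
  const-< {p} {q} p<q with ℚ.<-dense p<q
  ... | r , p<r , r<q = mk< (r ℚ.- p)
    (subst (ℚ._< r ℚ.- p) (ℚ.+-inverseʳ p) (ℚ.+-monoˡ-< (ℚ.- p) p<r))
    (0 , λ _ _ → subst (ℚ._< q)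
      (ℚS.solve 2 (λ p r → r ℚS.:= p ℚS.:+ (r ℚS.:- p)) refl p r) r<q)

  <-irrefl : ∀ x → ¬ (x < x)
  <-irrefl x (mk< η 0<η (N , f)) = ℚ.<-irrefl refl
    (ℚ.<-trans (subst (ℚ._< seq x N ℚ.+ η) (ℚ.+-identityʳ (seq x N)) (ℚ.+-monoʳ-< (seq x N) 0<η))
               (f N ℕ.≤-refl))

record ℂ : Set where
  constructor _+i_
  field
    re im : ℝ

open ℂ public

infix 4 _≈ᶜ_
infixl 6 _+ᶜ_
infixl 7 _*ᶜ_
infix  8 -ᶜ_

record _≈ᶜ_ (z w : ℂ) : Set where
  constructor _,_
  field
    re≈ : re z ≈ re w
    im≈ : im z ≈ im w

open _≈ᶜ_ public

_+ᶜ_ _*ᶜ_ : ℂ → ℂ → ℂ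
(a +i b) +ᶜ (c +i d) = (a + c) +i (b + d)
(a +i b) *ᶜ (c +i d) = (a * c - b * d) +i (a * d + b * c)

-ᶜ_ : ℂ → ℂ
-ᶜ (a +i b) = (- a) +i (- b)

fromℝ : ℝ → ℂ
fromℝ x = x +i 0ℝ

private
  +ᶜ-inverse : (∀ z → -ᶜ z +ᶜ z ≈ᶜ fromℝ 0ℝ) × (∀ z → z +ᶜ -ᶜ z ≈ᶜ fromℝ 0ℝ)
  +ᶜ-inverse = (λ z → +-inverseˡ (re z) , +-inverseˡ (im z))
             , (λ z → +-inverseʳ (re z) , +-inverseʳ (im z))

  *ᶜ-cong : ∀ {z w u v} → z ≈ᶜ w → u ≈ᶜ v → z *ᶜ u ≈ᶜ w *ᶜ v
  *ᶜ-cong (p , q) (r , s) = +-cong (*-cong p r) (-‿cong (*-cong q s))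
                          , +-cong (*-cong p s) (*-cong q r)

  module _ where
    open ℚS

    *ᶜ-comm : ∀ z w → z *ᶜ w ≈ᶜ w *ᶜ z
    *ᶜ-comm (a +i b) (c +i d) =
      (pointwise⇒≈ λ n → solve 4 (λ a b c d → a :* c :- b :* d := c :* a :- d :* b) refl
        (seq a n) (seq b n) (seq c n) (seq d n)) ,
      (pointwise⇒≈ λ n → solve 4 (λ a b c d → a :* d :+ b :* c := c :* b :+ d :* a) refl
        (seq a n) (seq b n) (seq c n) (seq d n))

    *ᶜ-assoc : ∀ z w u → (z *ᶜ w) *ᶜ u ≈ᶜ z *ᶜ (w *ᶜ u)
    *ᶜ-assoc (a +i b) (c +i d) (e +i f) =
      (pointwise⇒≈ λ n → solve 6 (λ a b c d e f →
        (a :* c :- b :* d) :* e :- (a :* d :+ b :* c) :* f :=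
        a :* (c :* e :- d :* f) :- b :* (c :* f :+ d :* e)) refl
        (seq a n) (seq b n) (seq c n) (seq d n) (seq e n) (seq f n)) ,
      (pointwise⇒≈ λ n → solve 6 (λ a b c d e f →
        (a :* c :- b :* d) :* f :+ (a :* d :+ b :* c) :* e :=
        a :* (c :* f :+ d :* e) :+ b :* (c :* e :- d :* f)) refl
        (seq a n) (seq b n) (seq c n) (seq d n) (seq e n) (seq f n))

    *ᶜ-identityˡ : ∀ z → fromℝ 1ℝ *ᶜ z ≈ᶜ z
    *ᶜ-identityˡ (a +i b) =
      (pointwise⇒≈ λ n → solve 2 (λ a b → con 1ℚ :* a :- con 0ℚ :* b := a) refl (seq a n) (seq b n)) ,
      (pointwise⇒≈ λ n → solve 2 (λ a b → con 1ℚ :* b :+ con 0ℚ :* a := b) refl (seq a n) (seq b n))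

    *ᶜ-distribˡ : ∀ z w u → z *ᶜ (w +ᶜ u) ≈ᶜ z *ᶜ w +ᶜ z *ᶜ u
    *ᶜ-distribˡ (a +i b) (c +i d) (e +i f) =
      (pointwise⇒≈ λ n → solve 6 (λ a b c d e f →
        a :* (c :+ e) :- b :* (d :+ f) := (a :* c :- b :* d) :+ (a :* e :- b :* f)) refl
        (seq a n) (seq b n) (seq c n) (seq d n) (seq e n) (seq f n)) ,
      (pointwise⇒≈ λ n → solve 6 (λ a b c d e f →
        a :* (d :+ f) :+ b :* (c :+ e) := (a :* d :+ b :* c) :+ (a :* f :+ b :* e)) refl
        (seq a n) (seq b n) (seq c n) (seq d n) (seq e n) (seq f n))

  ≈ᶜ-isEquivalence : IsEquivalence _≈ᶜ_
  ≈ᶜ-isEquivalence = record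
    { refl  = ℝR.refl , ℝR.refl
    ; sym   = λ (p , q) → ℝR.sym p , ℝR.sym q
    ; trans = λ (p , q) (r , s) → ℝR.trans p r , ℝR.trans q s
    }

  ℂ-setoid : Setoid 0ℓ 0ℓ
  ℂ-setoid = record { isEquivalence = ≈ᶜ-isEquivalence }

  +ᶜ-isAbelianGroup : IsAbelianGroup _≈ᶜ_ _+ᶜ_ (fromℝ 0ℝ) -ᶜ_
  +ᶜ-isAbelianGroup = record
    { isGroup = record
      { isMonoid = record
        { isSemigroup = record
          { isMagma = record
            { isEquivalence = ≈ᶜ-isEquivalence
            ; ∙-cong = λ (p , q) (r , s) → +-cong p r , +-cong q s
            }
          ; assoc = λ z w u → +-assoc (re z) (re w) (re u) , +-assoc (im z) (im w) (im u)
          }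
        ; identity = (λ z → +-identityˡ (re z) , +-identityˡ (im z))
                   , (λ z → +-identityʳ (re z) , +-identityʳ (im z))
        }
      ; inverse = +ᶜ-inverse
      ; ⁻¹-cong = λ (p , q) → -‿cong p , -‿cong q
      }
    ; comm = λ z w → +-comm (re z) (re w) , +-comm (im z) (im w)
    }

ℂ-commutativeRing : CommutativeRing 0ℓ 0ℓ
ℂ-commutativeRing = record
  { Carrier = ℂ
  ; _≈_ = _≈ᶜ_
  ; _+_ = _+ᶜ_
  ; _*_ = _*ᶜ_
  ; -_  = -ᶜ_
  ; 0#  = fromℝ 0ℝ
  ; 1#  = fromℝ 1ℝ
  ; isCommutativeRing = record
    { isRing = record
      { +-isAbelianGroup = +ᶜ-isAbelianGroup
      ; *-cong = *ᶜ-cong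
      ; *-assoc = *ᶜ-assoc
      ; *-identity = comm∧idˡ⇒id ℂ-setoid *ᶜ-comm *ᶜ-identityˡ
      ; distrib = comm∧distrˡ⇒distr ℂ-setoid (IsAbelianGroup.∙-cong +ᶜ-isAbelianGroup) *ᶜ-comm *ᶜ-distribˡ
      }
    ; *-comm = *ᶜ-comm
    }
  }

module ℂR = CommutativeRing ℂ-commutativeRing

∣_∣² : ℂ → ℝ
∣ a +i b ∣² = a * a + b * b

ι : ℤ → ℂ
ι i = fromℝ (fromℤ i)

private
  /1-+ : ∀ i j → (i ℤ.+ j) ℚ./ 1 ≡ (i ℚ./ 1) ℚ.+ (j ℚ./ 1)
  /1-+ i j = ℚ.toℚᵘ-injective (ℚᵘ.≃-trans (ℚ.toℚᵘ-fromℚᵘ (mkℚᵘ (i ℤ.+ j) 0))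
    (ℚᵘ.≃-trans
      (*≡* (ℤSolver.+-*-Solver.solve 2
        (λ i j → (i :+ j) :* (con 1ℤ :* con 1ℤ) := (i :* con 1ℤ :+ j :* con 1ℤ) :* con 1ℤ) refl i j))
      (ℚᵘ.≃-sym (ℚᵘ.≃-trans (ℚ.toℚᵘ-homo-+ (i ℚ./ 1) (j ℚ./ 1))
        (ℚᵘ.+-cong (ℚ.toℚᵘ-fromℚᵘ (mkℚᵘ i 0)) (ℚ.toℚᵘ-fromℚᵘ (mkℚᵘ j 0)))))))
    where open ℤSolver.+-*-Solver

  /1-* : ∀ i j → (i ℤ.* j) ℚ./ 1 ≡ (i ℚ./ 1) ℚ.* (j ℚ./ 1)
  /1-* i j = ℚ.toℚᵘ-injective (ℚᵘ.≃-trans (ℚ.toℚᵘ-fromℚᵘ (mkℚᵘ (i ℤ.* j) 0))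
    (ℚᵘ.≃-trans
      (*≡* (ℤSolver.+-*-Solver.solve 2
        (λ i j → (i :* j) :* (con 1ℤ :* con 1ℤ) := (i :* j) :* con 1ℤ) refl i j))
      (ℚᵘ.≃-sym (ℚᵘ.≃-trans (ℚ.toℚᵘ-homo-* (i ℚ./ 1) (j ℚ./ 1))
        (ℚᵘ.*-cong (ℚ.toℚᵘ-fromℚᵘ (mkℚᵘ i 0)) (ℚ.toℚᵘ-fromℚᵘ (mkℚᵘ j 0)))))))
    where open ℤSolver.+-*-Solver

  /1-neg : ∀ i → (ℤ.- i) ℚ./ 1 ≡ ℚ.- (i ℚ./ 1)
  /1-neg i = ℚ.toℚᵘ-injective (ℚᵘ.≃-trans (ℚ.toℚᵘ-fromℚᵘ (mkℚᵘ (ℤ.- i) 0))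
    (ℚᵘ.≃-sym (ℚᵘ.≃-trans (ℚ.toℚᵘ-homo‿- (i ℚ./ 1))
        (ℚᵘ.-‿cong (ℚ.toℚᵘ-fromℚᵘ (mkℚᵘ i 0))))))

  ι-+ : ∀ i j → ι (i ℤ.+ j) ≈ᶜ ι i +ᶜ ι j
  ι-+ i j = (pointwise⇒≈ λ _ → /1-+ i j) , (pointwise⇒≈ λ _ → refl)

  ι-* : ∀ i j → ι (i ℤ.* j) ≈ᶜ ι i *ᶜ ι j
  ι-* i j =
    (pointwise⇒≈ λ _ → trans (/1-* i j) (solve 2 (λ a b → a :* b := a :* b :- con 0ℚ :* con 0ℚ) refl (i ℚ./ 1) (j ℚ./ 1))) ,
    (pointwise⇒≈ λ _ → solve 2 (λ a b → con 0ℚ := a :* con 0ℚ :+ con 0ℚ :* b) refl (i ℚ./ 1) (j ℚ./ 1))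
    where open ℚS

  ι-neg : ∀ i → ι (ℤ.- i) ≈ᶜ -ᶜ ι i
  ι-neg i = (pointwise⇒≈ λ _ → /1-neg i) , (pointwise⇒≈ λ _ → refl)

record TopSpace : Set₁ where
  field
    setoid : Setoid 0ℓ 0ℓ
  module S = Setoid setoid
  open S public using (Carrier) renaming (_≈_ to _∼_)
  field
    Open      : Pred Carrier 0ℓ → Set
    open-resp : ∀ {P} → Open P → P Respects _∼_
    open-≐    : ∀ {P Q} → P ≐ Q → Open P → Open Q
    open-univ : Open λ _ → ⊤
    open-∩    : ∀ {P Q} → Open P → Open Q → Open (P ∩ Q)
    open-⋃    : ∀ {I : Set} {P : I → Pred Carrier 0ℓ} → (∀ i → Open (P i)) → Open (⋃ I P)

record ContinuousMap (X Y : TopSpace) : Set₁ where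
  private
    module X = TopSpace X
    module Y = TopSpace Y
  field
    to         : X.Carrier → Y.Carrier
    to-cong    : ∀ {x y} → x X.∼ y → to x Y.∼ to y
    continuous : ∀ {P} → Y.Open P → X.Open (P ∘ to)

open ContinuousMap public

_∘ᶜ_ : ∀ {X Y Z} → ContinuousMap Y Z → ContinuousMap X Y → ContinuousMap X Z
(f ∘ᶜ g) .to         = to f ∘ to g
(f ∘ᶜ g) .to-cong    = to-cong f ∘ to-cong g
(f ∘ᶜ g) .continuous = continuous g ∘ continuous f

-- B x ε (ε > 0) are the basic neighbourhoods of x.
module _ (S : Setoid 0ℓ 0ℓ)
         (B : Setoid.Carrier S → ℚ → Pred (Setoid.Carrier S) 0ℓ)
         (mono : ∀ {x ε δ} → ε ℚ.≤ δ → B x ε ⊆ B x δ) where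

  open Setoid S using () renaming (_≈_ to _∼_)

  nbhdTopology : TopSpace
  nbhdTopology = record
    { setoid    = S
    ; Open      = λ P → (P Respects _∼_) × (∀ {x} → P x → ∃[ ε ] (0ℚ ℚ.< ε) × (B x ε ⊆ P))
    ; open-resp = proj₁
    ; open-≐    = λ (P⊆Q , Q⊆P) (r , o) →
        (λ x∼y → P⊆Q ∘ r x∼y ∘ Q⊆P) ,
        λ q → let ε , 0<ε , b = o (Q⊆P q) in ε , 0<ε , P⊆Q ∘ b
    ; open-univ = (λ _ _ → tt) , λ _ → 1ℚ , 0<1 , λ _ → tt
    ; open-∩    = λ (r , o) (s , o′) →
        (λ x∼y (p , q) → r x∼y p , s x∼y q) ,
        λ (p , q) → let ε , 0<ε , b = o p ; δ , 0<δ , c = o′ q in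
          ε ℚ.⊓ δ , min-pos 0<ε 0<δ ,
          λ y∈B → b (mono (ℚ.p⊓q≤p ε δ) y∈B) , c (mono (ℚ.p⊓q≤q ε δ) y∈B)
    ; open-⋃    = λ o →
        (λ x∼y (i , p) → i , proj₁ (o i) x∼y p) ,
        λ (i , p) → let ε , 0<ε , b = proj₂ (o i) p in ε , 0<ε , λ y∈B → i , b y∈B
    }
    where
    min-pos : ∀ {ε δ} → 0ℚ ℚ.< ε → 0ℚ ℚ.< δ → 0ℚ ℚ.< ε ℚ.⊓ δ
    min-pos {ε} {δ} 0<ε 0<δ with ℚ.⊓-sel ε δ
    ... | inj₁ eq = subst (0ℚ ℚ.<_) (sym eq) 0<ε
    ... | inj₂ eq = subst (0ℚ ℚ.<_) (sym eq) 0<δ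

quotient : (X : TopSpace) (_≈′_ : Rel (TopSpace.Carrier X) 0ℓ) →
           IsEquivalence _≈′_ → (∀ {x y} → TopSpace._∼_ X x y → x ≈′ y) → TopSpace
quotient X _≈′_ equiv _ = record
  { setoid    = record { isEquivalence = equiv }
  ; Open      = λ P → (P Respects _≈′_) × Open P
  ; open-resp = proj₁
  ; open-≐    = λ P≐Q (r , o) →
      (λ x∼y → proj₁ P≐Q ∘ r x∼y ∘ proj₂ P≐Q) , open-≐ P≐Q o
  ; open-univ = (λ _ _ → tt) , open-univ
  ; open-∩    = λ (r , o) (s , o′) → (λ x∼y (p , q) → r x∼y p , s x∼y q) , open-∩ o o′
  ; open-⋃    = λ o → (λ x∼y (i , p) → i , proj₁ (o i) x∼y p) , open-⋃ (proj₂ ∘ o)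
  }
  where open TopSpace X

record SimplexPoint (n : ℕ) : Set where
  field
    coord    : Vector ℝ (suc n)
    coord≥0  : ∀ i → 0ℝ ≤ coord i
    sum≈1    : ℝΣ.sum coord ≈ 1ℝ

open SimplexPoint public

Δ : ℕ → TopSpace
Δ n = nbhdTopology
  (record
    { Carrier = SimplexPoint n
    ; _≈_ = λ s t → ∀ i → coord s i ≈ coord t i
    ; isEquivalence = record
      { refl  = λ _ → ℝR.refl
      ; sym   = λ s∼t i → ℝR.sym (s∼t i)
      ; trans = λ s∼t t∼u i → ℝR.trans (s∼t i) (t∼u i)
      }
    })
  (λ s ε t → ∀ i → Near ε (coord s i) (coord t i))
  (λ ε≤δ near i → Near-mono ε≤δ (near i))

private
  insertAt-All₂ : ∀ {R : Rel ℝ 0ℓ} {n} {x y : Vector ℝ n} (i : Fin (suc n)) →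
                  R 0ℝ 0ℝ → (∀ j → R (x j) (y j)) →
                  ∀ j → R (insertAt x i 0ℝ j) (insertAt y i 0ℝ j)
  insertAt-All₂             zero    r f zero    = r
  insertAt-All₂             zero    r f (suc j) = f j
  insertAt-All₂ {n = suc n} (suc i) r f zero    = f zero
  insertAt-All₂ {R} {n = suc n} (suc i) r f (suc j) = insertAt-All₂ {R} i r (f ∘ suc) j

  sum-insertAt : ∀ {n} (x : Vector ℝ n) i → ℝΣ.sum (insertAt x i 0ℝ) ≈ ℝΣ.sum x
  sum-insertAt x i = begin
    ℝΣ.sum (insertAt x i 0ℝ)
      ≈⟨ ℝΣ.sum-remove {i = i} (insertAt x i 0ℝ) ⟩
    insertAt x i 0ℝ i + ℝΣ.sum (removeAt (insertAt x i 0ℝ) i)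
      ≈⟨ ℝR.+-cong (ℝR.reflexive (insertAt-lookup x i 0ℝ))
                   (ℝΣ.sum-cong-≋ λ j → ℝR.reflexive (removeAt-insertAt x i 0ℝ j)) ⟩
    0ℝ + ℝΣ.sum x
      ≈⟨ ℝR.+-identityˡ _ ⟩
    ℝΣ.sum x ∎
    where open SetoidReasoning ℝR.setoid

  Near-0 : ∀ {ε} → 0ℚ ℚ.< ε → Near ε 0ℝ 0ℝ
  Near-0 {ε} 0<ε = 0-0<ε , 0-0<ε
    where
    0-0<ε : 0ℝ - 0ℝ < fromℚ ε
    0-0<ε = let mk< η 0<η (N , f) = const-< 0<ε in mk< η 0<η (N , f)

face : ∀ {n} → Fin (suc (suc n)) → ContinuousMap (Δ n) (Δ (suc n))
face i .to s = record
  { coord   = insertAt (coord s) i 0ℝ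
  ; coord≥0 = insertAt-All₂ {R = λ x _ → 0ℝ ≤ x} {y = coord s} i (<-irrefl 0ℝ) (coord≥0 s)
  ; sum≈1   = ℝR.trans (sum-insertAt (coord s) i) (sum≈1 s)
  }
face i .to-cong = insertAt-All₂ {R = _≈_} i ℝR.refl
face i .continuous (r , o) =
  (λ s∼t → r (insertAt-All₂ {R = _≈_} i ℝR.refl s∼t)) ,
  λ p → let ε , 0<ε , b = o p in
    ε , 0<ε , λ near → b (insertAt-All₂ {R = Near ε} i (Near-0 0<ε) near)

-- The free real vector space on a setoid: formal linear combinations
-- modulo the congruence generated by the vector space axioms.
module FreeModule {a ℓ} (S : Setoid a ℓ) where
  open Setoid S using () renaming (Carrier to G; _≈_ to _∼_)

  infix  4 _≋_
  infixl 6 _⊕_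
  infixr 7 _·_
  infixr 8 ⊖_

  data Free : Set a where
    gen : G → Free
    𝟘   : Free
    _⊕_ : Free → Free → Free
    ⊖_  : Free → Free
    _·_ : ℝ → Free → Free

  data _≋_ : Rel Free (a ⊔ ℓ) where
    gen-cong    : ∀ {g h} → g ∼ h → gen g ≋ gen h
    ≋-refl      : ∀ {x} → x ≋ x
    ≋-sym       : ∀ {x y} → x ≋ y → y ≋ x
    ≋-trans     : ∀ {x y z} → x ≋ y → y ≋ z → x ≋ z
    ⊕-cong      : ∀ {x y u v} → x ≋ y → u ≋ v → x ⊕ u ≋ y ⊕ v
    ⊖-cong      : ∀ {x y} → x ≋ y → ⊖ x ≋ ⊖ y
    ·-cong      : ∀ {r s x y} → r ≈ s → x ≋ y → r · x ≋ s · y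
    ⊕-assoc     : ∀ x y z → (x ⊕ y) ⊕ z ≋ x ⊕ (y ⊕ z)
    ⊕-comm      : ∀ x y → x ⊕ y ≋ y ⊕ x
    ⊕-identityˡ : ∀ x → 𝟘 ⊕ x ≋ x
    ⊖-inverseˡ  : ∀ x → ⊖ x ⊕ x ≋ 𝟘
    ·-zeroˡ     : ∀ x → 0ℝ · x ≋ 𝟘
    ·-zeroʳ     : ∀ r → r · 𝟘 ≋ 𝟘
    ·-identityˡ : ∀ x → 1ℝ · x ≋ x
    ·-assoc     : ∀ r s x → (r * s) · x ≋ r · s · x
    ·-distribʳ  : ∀ x r s → (r + s) · x ≋ r · x ⊕ s · x
    ·-distribˡ  : ∀ r x y → r · (x ⊕ y) ≋ r · x ⊕ r · y

  freeModule : Module ℝ-commutativeRing a (a ⊔ ℓ)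
  freeModule = record
    { Carrierᴹ = Free
    ; _≈ᴹ_ = _≋_
    ; _+ᴹ_ = _⊕_
    ; _*ₗ_ = _·_
    ; _*ᵣ_ = λ x r → r · x
    ; 0ᴹ   = 𝟘
    ; -ᴹ_  = ⊖_
    ; isModule = IsModuleFromLeft.isModule {commutativeRing = ℝ-commutativeRing} record
      { isLeftModule = record
        { isLeftSemimodule = record
          { +ᴹ-isCommutativeMonoid = record
            { isMonoid = record
              { isSemigroup = record
                { isMagma = record
                  { isEquivalence = record { refl = ≋-refl ; sym = ≋-sym ; trans = ≋-trans }
                  ; ∙-cong = ⊕-cong
                  }
                ; assoc = ⊕-assoc
                }
              ; identity = ⊕-identityˡ , λ x → ≋-trans (⊕-comm x 𝟘) (⊕-identityˡ x)
              }
            ; comm = ⊕-comm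
            }
          ; isPreleftSemimodule = record
            { *ₗ-cong      = ·-cong
            ; *ₗ-zeroˡ     = ·-zeroˡ
            ; *ₗ-distribʳ  = ·-distribʳ
            ; *ₗ-identityˡ = ·-identityˡ
            ; *ₗ-assoc     = ·-assoc
            ; *ₗ-zeroʳ     = ·-zeroʳ
            ; *ₗ-distribˡ  = ·-distribˡ
            }
          }
        ; -ᴹ‿cong    = ⊖-cong
        ; -ᴹ‿inverse = ⊖-inverseˡ , λ x → ≋-trans (⊕-comm x (⊖ x)) (⊖-inverseˡ x)
        }
      }
    }

module Singular (X : TopSpace) where
  private module X = TopSpace X

  simplices : ℕ → Setoid (lsuc 0ℓ) 0ℓ
  simplices n = record
    { Carrier = ContinuousMap (Δ n) X
    ; _≈_ = λ σ τ → ∀ s → to σ s X.∼ to τ s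
    ; isEquivalence = record
      { refl  = λ _ → X.S.refl
      ; sym   = λ σ∼τ s → X.S.sym (σ∼τ s)
      ; trans = λ σ∼τ τ∼υ s → X.S.trans (σ∼τ s) (τ∼υ s)
      }
    }

  C : ℕ → Module ℝ-commutativeRing (lsuc 0ℓ) (lsuc 0ℓ)
  C n = FreeModule.freeModule (simplices n)

  open FreeModule hiding (_≋_; freeModule)

  Chain : ℕ → Set₁
  Chain n = Free (simplices n)

  private module ∑ n = CommutativeMonoidSum (Module.+ᴹ-commutativeMonoid (C n))

  open SemiringExp ℝR.semiring using (_^_)

  ∂ : ∀ {n} → Chain (suc n) → Chain n
  ∂ {n} (gen σ) = ∑.sum n λ i → ((- 1ℝ) ^ toℕ i) · gen (σ ∘ᶜ face i)
  ∂ 𝟘       = 𝟘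
  ∂ (x ⊕ y) = ∂ x ⊕ ∂ y
  ∂ (⊖ x)   = ⊖ ∂ x
  ∂ (r · x) = r · ∂ x

  ∂-cong : ∀ {n} {x y : Chain (suc n)} →
           Module._≈ᴹ_ (C (suc n)) x y → Module._≈ᴹ_ (C n) (∂ x) (∂ y)
  ∂-cong {n} (gen-cong {σ} {τ} σ∼τ) = ∑.sum-cong-≋ n
    {_} {λ i → ((- 1ℝ) ^ toℕ i) · gen (σ ∘ᶜ face i)} {λ i → ((- 1ℝ) ^ toℕ i) · gen (τ ∘ᶜ face i)} λ i →
    ·-cong ℝR.refl (gen-cong {g = σ ∘ᶜ face i} {h = τ ∘ᶜ face i} λ s → σ∼τ (to (face i) s))
  ∂-cong ≋-refl              = ≋-refl
  ∂-cong (≋-sym p)           = ≋-sym (∂-cong p)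
  ∂-cong (≋-trans p q)       = ≋-trans (∂-cong p) (∂-cong q)
  ∂-cong (⊕-cong p q)        = ⊕-cong (∂-cong p) (∂-cong q)
  ∂-cong (⊖-cong p)          = ⊖-cong (∂-cong p)
  ∂-cong (·-cong e p)        = ·-cong e (∂-cong p)
  ∂-cong (⊕-assoc x y z)     = ⊕-assoc (∂ x) (∂ y) (∂ z)
  ∂-cong (⊕-comm x y)        = ⊕-comm (∂ x) (∂ y)
  ∂-cong (⊕-identityˡ x)     = ⊕-identityˡ (∂ x)
  ∂-cong (⊖-inverseˡ x)      = ⊖-inverseˡ (∂ x)
  ∂-cong (·-zeroˡ x)         = ·-zeroˡ (∂ x)
  ∂-cong (·-zeroʳ r)         = ·-zeroʳ r
  ∂-cong (·-identityˡ x)     = ·-identityˡ (∂ x)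
  ∂-cong (·-assoc r s x)     = ·-assoc r s (∂ x)
  ∂-cong (·-distribʳ x r s)  = ·-distribʳ (∂ x) r s
  ∂-cong (·-distribˡ r x y)  = ·-distribˡ r (∂ x) (∂ y)

  open Module (C 1) using (_≈ᴹ_; +ᴹ-abelianGroup) renaming (≈ᴹ-setoid to C₁-setoid)
  private
    module C₁ = Module (C 1)
    open AbelianGroupProperties +ᴹ-abelianGroup
      using (⁻¹-∙-comm; ⁻¹-anti-homo‿-; \\-leftDividesʳ; inverseʳ-unique)
    open CommutativeSemigroupProperties
      (CommutativeMonoid.commutativeSemigroup C₁.+ᴹ-commutativeMonoid) using (interchange)
    open SetoidReasoning C₁-setoid

  record Cycle : Set₁ where
    constructor _,_
    field
      chain : Chain 1
      ∂≈0   : Module._≈ᴹ_ (C 0) (∂ chain) 𝟘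

  open Cycle public

  Homologous : Rel Cycle (lsuc 0ℓ)
  Homologous z w = ∃[ d ] (chain z ⊕ ⊖ chain w) ≈ᴹ ∂ {1} d

  private
    module C₀ = Module (C 0)
    module G₀ = AbelianGroupProperties C₀.+ᴹ-abelianGroup

    𝟘ᶻ : Cycle
    𝟘ᶻ = 𝟘 , C₀.≈ᴹ-refl

    _+ᶻ_ : Cycle → Cycle → Cycle
    (x , p) +ᶻ (y , q) = (x ⊕ y) , C₀.≈ᴹ-trans (C₀.+ᴹ-cong p q) (C₀.+ᴹ-identityˡ 𝟘)

    -ᶻ_ : Cycle → Cycle
    -ᶻ (x , p) = (⊖ x) , C₀.≈ᴹ-trans (C₀.-ᴹ‿cong p) G₀.ε⁻¹≈ε

    _·ᶻ_ : ℝ → Cycle → Cycle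
    r ·ᶻ (x , p) = (r · x) , C₀.≈ᴹ-trans (C₀.*ₗ-cong ℝR.refl p) (C₀.*ₗ-zeroʳ r)

    ≈⇒homologous : ∀ {z w} → chain z ≈ᴹ chain w → Homologous z w
    ≈⇒homologous {z} {w} eq =
      𝟘 , C₁.≈ᴹ-trans (C₁.+ᴹ-cong eq C₁.≈ᴹ-refl) (C₁.-ᴹ‿inverseʳ (chain w))

    ·-⊖ : ∀ r x → (⊖ (r · x)) ≈ᴹ (r · (⊖ x))
    ·-⊖ r x = C₁.≈ᴹ-sym (inverseʳ-unique (r · x) (r · (⊖ x)) (begin
      (r · x) ⊕ (r · (⊖ x))  ≈⟨ C₁.*ₗ-distribˡ r x (⊖ x) ⟨
      r · (x ⊕ (⊖ x))        ≈⟨ C₁.*ₗ-cong ℝR.refl (C₁.-ᴹ‿inverseʳ x) ⟩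
      r · 𝟘                  ≈⟨ C₁.*ₗ-zeroʳ r ⟩
      𝟘                      ∎))

    homologous-sym : ∀ {z w} → Homologous z w → Homologous w z
    homologous-sym {z} {w} (d , eq) =
      (⊖ d) , C₁.≈ᴹ-trans (C₁.≈ᴹ-sym (⁻¹-anti-homo‿- (chain z) (chain w))) (C₁.-ᴹ‿cong eq)

    homologous-trans : ∀ {z w u} → Homologous z w → Homologous w u → Homologous z u
    homologous-trans {x , _} {y , _} {t , _} (d , p) (e , q) = (d ⊕ e) , (begin
      x ⊕ (⊖ t)                       ≈⟨ C₁.+ᴹ-congˡ (\\-leftDividesʳ y (⊖ t)) ⟨
      x ⊕ ((⊖ y) ⊕ (y ⊕ (⊖ t)))       ≈⟨ C₁.+ᴹ-assoc x (⊖ y) (y ⊕ (⊖ t)) ⟨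
      (x ⊕ (⊖ y)) ⊕ (y ⊕ (⊖ t))       ≈⟨ C₁.+ᴹ-cong p q ⟩
      ∂ d ⊕ ∂ e                       ∎)

    +ᶻ-cong : ∀ {z w u v} → Homologous z w → Homologous u v → Homologous (z +ᶻ u) (w +ᶻ v)
    +ᶻ-cong {x , _} {y , _} {s , _} {t , _} (d , p) (e , q) = (d ⊕ e) , (begin
      (x ⊕ s) ⊕ (⊖ (y ⊕ t))           ≈⟨ C₁.+ᴹ-congˡ (⁻¹-∙-comm y t) ⟨
      (x ⊕ s) ⊕ ((⊖ y) ⊕ (⊖ t))       ≈⟨ interchange x s (⊖ y) (⊖ t) ⟩
      (x ⊕ (⊖ y)) ⊕ (s ⊕ (⊖ t))       ≈⟨ C₁.+ᴹ-cong p q ⟩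
      ∂ d ⊕ ∂ e                       ∎)

    -ᶻ-cong : ∀ {z w} → Homologous z w → Homologous (-ᶻ z) (-ᶻ w)
    -ᶻ-cong {x , _} {y , _} (d , p) =
      (⊖ d) , C₁.≈ᴹ-trans (⁻¹-∙-comm x (⊖ y)) (C₁.-ᴹ‿cong p)

    ·ᶻ-cong : ∀ {r s z w} → r ≈ s → Homologous z w → Homologous (r ·ᶻ z) (s ·ᶻ w)
    ·ᶻ-cong {r} {s} {x , _} {y , _} r≈s (d , p) = (r · d) , (begin
      (r · x) ⊕ (⊖ (s · y))  ≈⟨ C₁.+ᴹ-congˡ (C₁.-ᴹ‿cong (C₁.*ₗ-cong r≈s C₁.≈ᴹ-refl)) ⟨
      (r · x) ⊕ (⊖ (r · y))  ≈⟨ C₁.+ᴹ-congˡ (·-⊖ r y) ⟩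
      (r · x) ⊕ (r · (⊖ y))  ≈⟨ C₁.*ₗ-distribˡ r x (⊖ y) ⟨
      r · (x ⊕ (⊖ y))        ≈⟨ C₁.*ₗ-cong ℝR.refl p ⟩
      r · ∂ d                ∎)

  H₁ : Module ℝ-commutativeRing (lsuc 0ℓ) (lsuc 0ℓ)
  H₁ = record
    { Carrierᴹ = Cycle
    ; _≈ᴹ_ = Homologous
    ; _+ᴹ_ = _+ᶻ_
    ; _*ₗ_ = _·ᶻ_
    ; _*ᵣ_ = λ z r → r ·ᶻ z
    ; 0ᴹ   = 𝟘ᶻ
    ; -ᴹ_  = -ᶻ_
    ; isModule = IsModuleFromLeft.isModule {commutativeRing = ℝ-commutativeRing} record
      { isLeftModule = record
        { isLeftSemimodule = record
          { +ᴹ-isCommutativeMonoid = record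
            { isMonoid = record
              { isSemigroup = record
                { isMagma = record
                  { isEquivalence = record
                    { refl  = λ {z} → ≈⇒homologous {z} {z} C₁.≈ᴹ-refl
                    ; sym   = λ {z} {w} → homologous-sym {z} {w}
                    ; trans = λ {z} {w} {u} → homologous-trans {z} {w} {u}
                    }
                  ; ∙-cong = λ {z} {w} {u} {v} → +ᶻ-cong {z} {w} {u} {v}
                  }
                ; assoc = λ z w u → ≈⇒homologous {(z +ᶻ w) +ᶻ u} {z +ᶻ (w +ᶻ u)}
                    (C₁.+ᴹ-assoc (chain z) (chain w) (chain u))
                }
              ; identity = (λ z → ≈⇒homologous {𝟘ᶻ +ᶻ z} {z} (C₁.+ᴹ-identityˡ (chain z)))
                         , (λ z → ≈⇒homologous {z +ᶻ 𝟘ᶻ} {z} (C₁.+ᴹ-identityʳ (chain z)))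
              }
            ; comm = λ z w → ≈⇒homologous {z +ᶻ w} {w +ᶻ z} (C₁.+ᴹ-comm (chain z) (chain w))
            }
          ; isPreleftSemimodule = record
            { *ₗ-cong      = λ {r} {s} {z} {w} → ·ᶻ-cong {r} {s} {z} {w}
            ; *ₗ-zeroˡ     = λ z → ≈⇒homologous {0ℝ ·ᶻ z} {𝟘ᶻ} (C₁.*ₗ-zeroˡ (chain z))
            ; *ₗ-distribʳ  = λ z r s → ≈⇒homologous {(r + s) ·ᶻ z} {(r ·ᶻ z) +ᶻ (s ·ᶻ z)}
                (C₁.*ₗ-distribʳ (chain z) r s)
            ; *ₗ-identityˡ = λ z → ≈⇒homologous {1ℝ ·ᶻ z} {z} (C₁.*ₗ-identityˡ (chain z))
            ; *ₗ-assoc     = λ r s z → ≈⇒homologous {(r * s) ·ᶻ z} {r ·ᶻ (s ·ᶻ z)}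
                (C₁.*ₗ-assoc r s (chain z))
            ; *ₗ-zeroʳ     = λ r → ≈⇒homologous {r ·ᶻ 𝟘ᶻ} {𝟘ᶻ} (C₁.*ₗ-zeroʳ r)
            ; *ₗ-distribˡ  = λ r z w → ≈⇒homologous {r ·ᶻ (z +ᶻ w)} {(r ·ᶻ z) +ᶻ (r ·ᶻ w)}
                (C₁.*ₗ-distribˡ r (chain z) (chain w))
            }
          }
        ; -ᴹ‿cong    = λ {z} {w} → -ᶻ-cong {z} {w}
        ; -ᴹ‿inverse = (λ z → ≈⇒homologous {(-ᶻ z) +ᶻ z} {𝟘ᶻ} (C₁.-ᴹ‿inverseˡ (chain z)))
                     , (λ z → ≈⇒homologous {z +ᶻ (-ᶻ z)} {𝟘ᶻ} (C₁.-ᴹ‿inverseʳ (chain z)))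
        }
      }
    }

open Singular using (H₁) public

-- Matrices are taken in SL₂(ℤ): γ and -γ act in the same way, so the
-- orbits are those of the image in PSL₂(ℤ).
record Γ₀ (p : ℕ) : Set where
  field
    a b c d : ℤ
    det≡1   : a ℤ.* d ℤ.- b ℤ.* c ≡ 1ℤ
    p∣c     : ℤ.+ p ℤ∣.∣ c

record ℍ : Set where
  field
    point : ℂ
    im>0  : 0ℝ < im point

open ℍ public

-- w = (a z + b) / (c z + d), with the (nonzero) denominator cleared.
Moves : ∀ {p} → Γ₀ p → ℍ → ℍ → Set
Moves γ z w = point w *ᶜ (ι c *ᶜ point z +ᶜ ι d) ≈ᶜ ι a *ᶜ point z +ᶜ ι b
  where open Γ₀ γ

-- The point num / den of ℙ¹(ℚ) in lowest terms, ∞ being ±1 / 0; the pair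
-- (num , den) is determined up to a common sign.
record Cusp : Set where
  field
    num den : ℤ
    coprime : Coprime num den

open Cusp public

infix 4 _≡±_

data _≡±_ : Rel (ℤ × ℤ) 0ℓ where
  pos : ∀ {m n m′ n′} → m ≡ m′ → n ≡ n′ → (m , n) ≡± (m′ , n′)
  neg : ∀ {m n m′ n′} → m ≡ ℤ.- m′ → n ≡ ℤ.- n′ → (m , n) ≡± (m′ , n′)

coords : Cusp → ℤ × ℤ
coords s = num s , den s

apply : ∀ {p} → Γ₀ p → ℤ × ℤ → ℤ × ℤ
apply γ (m , n) = (a ℤ.* m ℤ.+ b ℤ.* n) , (c ℤ.* m ℤ.+ d ℤ.* n)
  where open Γ₀ γ

private
  module ℤS = ℤSolver.+-*-Solver

  identity : ∀ {p} → Γ₀ p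
  identity = record
    { a = 1ℤ ; b = 0ℤ ; c = 0ℤ ; d = 1ℤ ; det≡1 = refl ; p∣c = ℤ∣.divides 0ℤ refl }

  inverse : ∀ {p} → Γ₀ p → Γ₀ p
  inverse γ = record
    { a = d ; b = ℤ.- b ; c = ℤ.- c ; d = a
    ; det≡1 = trans (ℤS.solve 4 (λ a b c d →
        d ℤS.:* a ℤS.:- (ℤS.:- b) ℤS.:* (ℤS.:- c) ℤS.:= a ℤS.:* d ℤS.:- b ℤS.:* c) refl a b c d) det≡1
    ; p∣c = ℤ∣.∣m⇒∣-m p∣c
    }
    where open Γ₀ γ

  compose : ∀ {p} → Γ₀ p → Γ₀ p → Γ₀ p
  compose δ γ = record
    { a = D.a ℤ.* G.a ℤ.+ D.b ℤ.* G.c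
    ; b = D.a ℤ.* G.b ℤ.+ D.b ℤ.* G.d
    ; c = D.c ℤ.* G.a ℤ.+ D.d ℤ.* G.c
    ; d = D.c ℤ.* G.b ℤ.+ D.d ℤ.* G.d
    ; det≡1 = trans
        (ℤS.solve 8 (λ a b c d a′ b′ c′ d′ →
          (a′ :* a :+ b′ :* c) :* (c′ :* b :+ d′ :* d) :- (a′ :* b :+ b′ :* d) :* (c′ :* a :+ d′ :* c)
          := (a′ :* d′ :- b′ :* c′) :* (a :* d :- b :* c)) refl
          G.a G.b G.c G.d D.a D.b D.c D.d)
        (cong₂ ℤ._*_ D.det≡1 G.det≡1)
    ; p∣c = ℤ∣.∣m∣n⇒∣m+n (ℤ∣.∣m⇒∣m*n G.a D.p∣c) (ℤ∣.∣n⇒∣m*n D.d G.p∣c)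
    }
    where
    module D = Γ₀ δ
    module G = Γ₀ γ
    open ℤS

  open SetoidReasoning ℂR.setoid
  module ℂS = SemiringSolver ℂR.commutativeSemiring
  module ℂP = RingProperties ℂR.ring
  open AbelianGroupProperties ℂR.+-abelianGroup using (\\-leftDividesʳ)
  open ℂS using () renaming (_:+_ to _⊕_; _:*_ to _⊗_; _:=_ to _⊜_)

  moves-refl : ∀ {p} {z w : ℍ} → point z ≈ᶜ point w → Moves (identity {p}) z w
  moves-refl {z = z} {w} z≈w = begin
    w′ *ᶜ (ι 0ℤ *ᶜ z′ +ᶜ ι 1ℤ)  ≈⟨ ℂR.*-congˡ (ℂR.+-congʳ (ℂR.zeroˡ z′)) ⟩
    w′ *ᶜ (ι 0ℤ +ᶜ ι 1ℤ)        ≈⟨ ℂR.*-congˡ (ℂR.+-identityˡ (ι 1ℤ)) ⟩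
    w′ *ᶜ ι 1ℤ                  ≈⟨ ℂR.*-identityʳ w′ ⟩
    w′                          ≈⟨ z≈w ⟨
    z′                          ≈⟨ ℂR.*-identityˡ z′ ⟨
    ι 1ℤ *ᶜ z′                  ≈⟨ ℂR.+-identityʳ _ ⟨
    ι 1ℤ *ᶜ z′ +ᶜ ι 0ℤ          ∎
    where z′ = point z ; w′ = point w

  moves-sym : ∀ {p} (γ : Γ₀ p) {z w} → Moves γ z w → Moves (inverse γ) w z
  moves-sym γ {z} {w} eq = begin
    z′ *ᶜ (ι (ℤ.- c) *ᶜ w′ +ᶜ ι a)       ≈⟨ ℂR.*-congˡ (ℂR.+-congʳ (ℂR.*-congʳ (ι-neg c))) ⟩
    z′ *ᶜ (-ᶜ ι c *ᶜ w′ +ᶜ ι a)          ≈⟨ ℂR.*-congˡ (ℂR.+-congʳ (ℂP.-‿distribˡ-* (ι c) w′)) ⟨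
    z′ *ᶜ (-ᶜ (ι c *ᶜ w′) +ᶜ ι a)        ≈⟨ ℂR.distribˡ z′ _ _ ⟩
    z′ *ᶜ -ᶜ (ι c *ᶜ w′) +ᶜ z′ *ᶜ ι a    ≈⟨ ℂR.+-congʳ (ℂP.-‿distribʳ-* z′ _) ⟨
    -ᶜ x +ᶜ z′ *ᶜ ι a                    ≈⟨ ℂR.+-congˡ (ℂR.*-comm z′ (ι a)) ⟩
    -ᶜ x +ᶜ ι a *ᶜ z′                    ≈⟨ ℂR.+-congˡ az≈ ⟩
    -ᶜ x +ᶜ (x +ᶜ (ι d *ᶜ w′ +ᶜ -ᶜ ι b)) ≈⟨ \\-leftDividesʳ x _ ⟩
    ι d *ᶜ w′ +ᶜ -ᶜ ι b                  ≈⟨ ℂR.+-congˡ (ι-neg b) ⟨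
    ι d *ᶜ w′ +ᶜ ι (ℤ.- b)               ∎
    where
    open Γ₀ γ
    z′ = point z
    w′ = point w
    x  = z′ *ᶜ (ι c *ᶜ w′)
    az≈ : ι a *ᶜ z′ ≈ᶜ x +ᶜ (ι d *ᶜ w′ +ᶜ -ᶜ ι b)
    az≈ = begin
      ι a *ᶜ z′                                  ≈⟨ ℂR.+-identityʳ _ ⟨
      ι a *ᶜ z′ +ᶜ fromℝ 0ℝ                      ≈⟨ ℂR.+-congˡ (ℂR.-‿inverseʳ (ι b)) ⟨
      ι a *ᶜ z′ +ᶜ (ι b +ᶜ -ᶜ ι b)               ≈⟨ ℂR.+-assoc _ _ _ ⟨
      (ι a *ᶜ z′ +ᶜ ι b) +ᶜ -ᶜ ι b               ≈⟨ ℂR.+-congʳ eq ⟨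
      w′ *ᶜ (ι c *ᶜ z′ +ᶜ ι d) +ᶜ -ᶜ ι b         ≈⟨ ℂS.solve 5 (λ w c z d e →
          w ⊗ (c ⊗ z ⊕ d) ⊕ e ⊜ z ⊗ (c ⊗ w) ⊕ (d ⊗ w ⊕ e)) ℂR.refl w′ (ι c) z′ (ι d) (-ᶜ ι b) ⟩
      x +ᶜ (ι d *ᶜ w′ +ᶜ -ᶜ ι b)                 ∎

  ι-lin : ∀ i j k l → ι (i ℤ.* j ℤ.+ k ℤ.* l) ≈ᶜ ι i *ᶜ ι j +ᶜ ι k *ᶜ ι l
  ι-lin i j k l = ℂR.trans (ι-+ (i ℤ.* j) (k ℤ.* l)) (ℂR.+-cong (ι-* i j) (ι-* k l))

  moves-trans : ∀ {p} (γ δ : Γ₀ p) {z w u} → Moves γ z w → Moves δ w u → Moves (compose δ γ) z u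
  moves-trans γ δ {z} {w} {u} eq eq′ = begin
    u′ *ᶜ (ι (D.c ℤ.* G.a ℤ.+ D.d ℤ.* G.c) *ᶜ z′ +ᶜ ι (D.c ℤ.* G.b ℤ.+ D.d ℤ.* G.d))
      ≈⟨ ℂR.*-congˡ (expand D.c D.d) ⟩
    u′ *ᶜ (ι D.c *ᶜ numer +ᶜ ι D.d *ᶜ denom)
      ≈⟨ ℂR.*-congˡ (ℂR.+-congʳ (ℂR.*-congˡ eq)) ⟨
    u′ *ᶜ (ι D.c *ᶜ (w′ *ᶜ denom) +ᶜ ι D.d *ᶜ denom)
      ≈⟨ ℂR.*-congˡ (pull (ι D.c) (ι D.d)) ⟩
    u′ *ᶜ ((ι D.c *ᶜ w′ +ᶜ ι D.d) *ᶜ denom)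
      ≈⟨ ℂR.*-assoc u′ _ denom ⟨
    (u′ *ᶜ (ι D.c *ᶜ w′ +ᶜ ι D.d)) *ᶜ denom
      ≈⟨ ℂR.*-congʳ eq′ ⟩
    (ι D.a *ᶜ w′ +ᶜ ι D.b) *ᶜ denom
      ≈⟨ pull (ι D.a) (ι D.b) ⟨
    ι D.a *ᶜ (w′ *ᶜ denom) +ᶜ ι D.b *ᶜ denom
      ≈⟨ ℂR.+-congʳ (ℂR.*-congˡ eq) ⟩
    ι D.a *ᶜ numer +ᶜ ι D.b *ᶜ denom
      ≈⟨ expand D.a D.b ⟨
    ι (D.a ℤ.* G.a ℤ.+ D.b ℤ.* G.c) *ᶜ z′ +ᶜ ι (D.a ℤ.* G.b ℤ.+ D.b ℤ.* G.d) ∎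
    where
    module G = Γ₀ γ
    module D = Γ₀ δ
    z′ = point z
    w′ = point w
    u′ = point u
    numer = ι G.a *ᶜ z′ +ᶜ ι G.b
    denom = ι G.c *ᶜ z′ +ᶜ ι G.d
    expand : ∀ i j → ι (i ℤ.* G.a ℤ.+ j ℤ.* G.c) *ᶜ z′ +ᶜ ι (i ℤ.* G.b ℤ.+ j ℤ.* G.d)
                     ≈ᶜ ι i *ᶜ numer +ᶜ ι j *ᶜ denom
    expand i j = ℂR.trans
      (ℂR.+-cong (ℂR.*-congʳ (ι-lin i G.a j G.c)) (ι-lin i G.b j G.d))
      (ℂS.solve 7 (λ i j a b c d z →
        (i ⊗ a ⊕ j ⊗ c) ⊗ z ⊕ (i ⊗ b ⊕ j ⊗ d) ⊜ i ⊗ (a ⊗ z ⊕ b) ⊕ j ⊗ (c ⊗ z ⊕ d)) ℂR.refl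
        (ι i) (ι j) (ι G.a) (ι G.b) (ι G.c) (ι G.d) z′)
    pull : ∀ i j → i *ᶜ (w′ *ᶜ denom) +ᶜ j *ᶜ denom ≈ᶜ (i *ᶜ w′ +ᶜ j) *ᶜ denom
    pull i j = ℂR.trans (ℂR.+-congʳ (ℂR.sym (ℂR.*-assoc i w′ denom)))
                        (ℂR.sym (ℂR.distribʳ denom (i *ᶜ w′) j))

  ≡±-refl : ∀ {x} → x ≡± x
  ≡±-refl = pos refl refl

  ≡±-sym : ∀ {x y} → x ≡± y → y ≡± x
  ≡±-sym (pos refl refl) = pos refl refl
  ≡±-sym (neg refl refl) = neg (sym (ℤ.neg-involutive _)) (sym (ℤ.neg-involutive _))

  ≡±-trans : ∀ {x y z} → x ≡± y → y ≡± z → x ≡± z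
  ≡±-trans (pos refl refl) q               = q
  ≡±-trans (neg p p′)      (pos refl refl) = neg p p′
  ≡±-trans (neg refl refl) (neg refl refl) = pos (ℤ.neg-involutive _) (ℤ.neg-involutive _)

  neg-lin : ∀ a b m n → a ℤ.* (ℤ.- m) ℤ.+ b ℤ.* (ℤ.- n) ≡ ℤ.- (a ℤ.* m ℤ.+ b ℤ.* n)
  neg-lin = ℤS.solve 4 (λ a b m n →
    a ℤS.:* (ℤS.:- m) ℤS.:+ b ℤS.:* (ℤS.:- n) ℤS.:= ℤS.:- (a ℤS.:* m ℤS.:+ b ℤS.:* n)) refl

  apply-≡± : ∀ {p} (γ : Γ₀ p) {x y} → x ≡± y → apply γ x ≡± apply γ y
  apply-≡± γ             (pos refl refl) = ≡±-refl
  apply-≡± γ {y = m , n} (neg refl refl) = neg (neg-lin a b m n) (neg-lin c d m n)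
    where open Γ₀ γ

  apply-identity : ∀ {p} x → apply (identity {p}) x ≡± x
  apply-identity (m , n) = pos
    (ℤS.solve 2 (λ m n → ℤS.con 1ℤ ℤS.:* m ℤS.:+ ℤS.con 0ℤ ℤS.:* n ℤS.:= m) refl m n)
    (ℤS.solve 2 (λ m n → ℤS.con 0ℤ ℤS.:* m ℤS.:+ ℤS.con 1ℤ ℤS.:* n ℤS.:= n) refl m n)

  apply-compose : ∀ {p} (δ γ : Γ₀ p) x → apply (compose δ γ) x ≡± apply δ (apply γ x)
  apply-compose δ γ (m , n) = pos (lin D.a D.b) (lin D.c D.d)
    where
    module G = Γ₀ γ
    module D = Γ₀ δ
    open ℤS
    lin : ∀ i j → (i ℤ.* G.a ℤ.+ j ℤ.* G.c) ℤ.* m ℤ.+ (i ℤ.* G.b ℤ.+ j ℤ.* G.d) ℤ.* n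
                  ≡ i ℤ.* (G.a ℤ.* m ℤ.+ G.b ℤ.* n) ℤ.+ j ℤ.* (G.c ℤ.* m ℤ.+ G.d ℤ.* n)
    lin i j = solve 8 (λ i j a b c d m n →
      (i :* a :+ j :* c) :* m :+ (i :* b :+ j :* d) :* n
      := i :* (a :* m :+ b :* n) :+ j :* (c :* m :+ d :* n)) refl i j G.a G.b G.c G.d m n

  apply-inverse : ∀ {p} (γ : Γ₀ p) x → apply (inverse γ) (apply γ x) ≡± x
  apply-inverse γ (m , n) = pos
    (trans (solve 6 (λ a b c d m n →
        d :* (a :* m :+ b :* n) :+ (:- b) :* (c :* m :+ d :* n) := (a :* d :- b :* c) :* m) refl a b c d m n)
      (trans (cong (ℤ._* m) det≡1) (ℤ.*-identityˡ m)))
    (trans (solve 6 (λ a b c d m n →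
        (:- c) :* (a :* m :+ b :* n) :+ a :* (c :* m :+ d :* n) := (a :* d :- b :* c) :* n) refl a b c d m n)
      (trans (cong (ℤ._* n) det≡1) (ℤ.*-identityˡ n)))
    where
    open Γ₀ γ
    open ℤS

ℍ-setoid : Setoid 0ℓ 0ℓ
ℍ-setoid = record
  { Carrier = ℍ
  ; _≈_ = λ z w → point z ≈ᶜ point w
  ; isEquivalence = record { refl = ℂR.refl ; sym = ℂR.sym ; trans = ℂR.trans }
  }

Cusp-setoid : Setoid 0ℓ 0ℓ
Cusp-setoid = record
  { Carrier = Cusp
  ; _≈_ = λ s t → coords s ≡± coords t
  ; isEquivalence = record { refl = ≡±-refl ; sym = ≡±-sym ; trans = ≡±-trans }
  }

ℍ/Γ₀ : ℕ → Setoid 0ℓ 0ℓ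
ℍ/Γ₀ p = record
  { Carrier = ℍ
  ; _≈_ = λ z w → Σ (Γ₀ p) λ γ → Moves γ z w
  ; isEquivalence = record
    { refl  = λ {z} → identity , moves-refl {p} {z} {z} ℂR.refl
    ; sym   = λ {z} {w} (γ , eq) → inverse γ , moves-sym γ {z} {w} eq
    ; trans = λ {z} {w} {u} (γ , eq) (δ , eq′) → compose δ γ , moves-trans γ δ {z} {w} {u} eq eq′
    }
  }

Cusp/Γ₀ : ℕ → Setoid 0ℓ 0ℓ
Cusp/Γ₀ p = record
  { Carrier = Cusp
  ; _≈_ = λ s t → Σ (Γ₀ p) λ γ → apply γ (coords s) ≡± coords t
  ; isEquivalence = record
    { refl  = λ {s} → identity , apply-identity {p} (coords s)
    ; sym   = λ {s} {t} (γ , eq) → inverse γ ,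
        ≡±-trans (apply-≡± (inverse γ) (≡±-sym eq)) (apply-inverse γ (coords s))
    ; trans = λ {s} {t} {u} (γ , eq) (δ , eq′) → compose δ γ ,
        ≡±-trans (apply-compose δ γ (coords s)) (≡±-trans (apply-≡± δ eq) eq′)
    }
  }

Disc : ℍ → ℚ → Pred ℍ 0ℓ
Disc z ε w = Near ε (re (point z)) (re (point w)) × Near ε (im (point z)) (im (point w))

-- im w > ε⁻¹ ∣ num - den w ∣²: the half-plane im w > ε⁻¹ at ∞, and a disc
-- tangent to the real axis at num / den when den ≠ 0.
Horodisc : Cusp → ℚ → Pred ℍ 0ℓ
Horodisc s ε w = ∣ ι (num s) +ᶜ -ᶜ (ι (den s) *ᶜ point w) ∣² < fromℚ ε * im (point w)

Nbhd* : ℍ ⊎ Cusp → ℚ → Pred (ℍ ⊎ Cusp) 0ℓ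
Nbhd* (inj₁ z) ε (inj₁ w) = Disc z ε w
Nbhd* (inj₁ z) ε (inj₂ t) = ⊥
Nbhd* (inj₂ s) ε (inj₁ w) = Horodisc s ε w
Nbhd* (inj₂ s) ε (inj₂ t) = coords s ≡± coords t

private
  Disc-mono : ∀ {z ε δ} → ε ℚ.≤ δ → Disc z ε ⊆ Disc z δ
  Disc-mono ε≤δ (p , q) = Near-mono ε≤δ p , Near-mono ε≤δ q

  Horodisc-mono : ∀ {s ε δ} → ε ℚ.≤ δ → Horodisc s ε ⊆ Horodisc s δ
  Horodisc-mono ε≤δ {w} h = mk< (gap h) (gap>0 h)
    (both (λ {n} lt pos → ℚ.<-≤-trans lt
        (ℚ.*-monoʳ-≤-nonNeg (seq (im (point w)) n) {{ℚ.nonNegative (ℚ.<⇒≤ (y>0 {n} pos))}} ε≤δ))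
      (bounded h) (bounded (im>0 w)))
    where
    y>0 : ∀ {n} → 0ℚ ℚ.+ gap (im>0 w) ℚ.< seq (im (point w)) n → 0ℚ ℚ.< seq (im (point w)) n
    y>0 lt = ℚ.<-trans (gap>0 (im>0 w)) (subst (ℚ._< _) (ℚ.+-identityˡ _) lt)

  Nbhd*-mono : ∀ {x ε δ} → ε ℚ.≤ δ → Nbhd* x ε ⊆ Nbhd* x δ
  Nbhd*-mono {inj₁ z} ε≤δ {inj₁ w} = Disc-mono {z} ε≤δ {w}
  Nbhd*-mono {inj₁ z} ε≤δ {inj₂ t} ()
  Nbhd*-mono {inj₂ s} ε≤δ {inj₁ w} = Horodisc-mono {s} ε≤δ {w}
  Nbhd*-mono {inj₂ s} ε≤δ {inj₂ t} eq = eq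

ℍ-space : TopSpace
ℍ-space = nbhdTopology ℍ-setoid Disc λ {z} ε≤δ {w} → Disc-mono {z} ε≤δ {w}

ℍ*-space : TopSpace
ℍ*-space = nbhdTopology (ℍ-setoid ⊎ₛ Cusp-setoid) Nbhd* λ {x} ε≤δ {y} → Nbhd*-mono {x} ε≤δ {y}

private
  ≈⇒orbit : ∀ p {z w} → Setoid._≈_ ℍ-setoid z w → Setoid._≈_ (ℍ/Γ₀ p) z w
  ≈⇒orbit p {z} {w} z≈w = identity , moves-refl {p} {z} {w} z≈w

  ≈*⇒orbit : ∀ p {x y} → Setoid._≈_ (ℍ-setoid ⊎ₛ Cusp-setoid) x y →
             Setoid._≈_ (ℍ/Γ₀ p ⊎ₛ Cusp/Γ₀ p) x y
  ≈*⇒orbit p (inj₁ {z} {w} z≈w) = inj₁ (≈⇒orbit p {z} {w} z≈w)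
  ≈*⇒orbit p (inj₂ {s} s≈t)     = inj₂ (identity , ≡±-trans (apply-identity {p} (coords s)) s≈t)

Y₀ : ℕ → TopSpace
Y₀ p = quotient ℍ-space _ (Setoid.isEquivalence (ℍ/Γ₀ p)) λ {z} {w} → ≈⇒orbit p {z} {w}

-- The compactification Γ₀(p)\(ℍ ∪ ℙ¹(ℚ)) of Y₀(p).
X₀ : ℕ → TopSpace
X₀ p = quotient ℍ*-space _ (Setoid.isEquivalence (ℍ/Γ₀ p ⊎ₛ Cusp/Γ₀ p)) (≈*⇒orbit p)

module Linear {m ℓm} (V : Module ℝ-commutativeRing m ℓm) where
  open Module V
  private module ∑ = CommutativeMonoidSum +ᴹ-commutativeMonoid

  linComb : ∀ {n} → Vector ℝ n → Vector Carrierᴹ n → Carrierᴹ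
  linComb r v = ∑.sum λ j → r j *ₗ v j

  record IsBasis {n} (v : Vector Carrierᴹ n) : Set (m ⊔ ℓm) where
    field
      independent : ∀ r → linComb r v ≈ᴹ 0ᴹ → ∀ j → r j ≈ 0ℝ
      spanning    : ∀ x → ∃[ r ] x ≈ᴹ linComb r v

  Solves : ∀ {N M L} → (Fin N → Fin L → ℝ) → (Fin M → Fin L → ℝ) →
           Vector Carrierᴹ M → Vector Carrierᴹ N → Set ℓm
  Solves a b v x = ∀ k → linComb (λ i → a i k) x +ᴹ linComb (λ j → b j k) v ≈ᴹ 0ᴹ

sumOver : ∀ {n} → Subset n → Vector ℝ n → ℝ
sumOver A r = ℝΣ.sum λ k → if lookup A k then r k else 0ℝ

∈[-1,0,1] : Pred ℝ 0ℓ
∈[-1,0,1] r = r ≈ - 1ℝ ⊎ r ≈ 0ℝ ⊎ r ≈ 1ℝ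

-- The genus of Y₀(p) is that of the closed surface X₀(p) obtained by filling
-- in the cusps, i.e. half of the first Betti number of X₀(p).
IsGenus : ℕ → ℕ → Set₁
IsGenus p g = ∃ λ (v : Vector (Module.Carrierᴹ (H₁ (X₀ p))) (2 ℕ.* g)) → Linear.IsBasis (H₁ (X₀ p)) v

V : ℕ → Module ℝ-commutativeRing (lsuc 0ℓ) (lsuc 0ℓ)
V p = H₁ (Y₀ p)

{-# OPTIONS --safe #-}

-- By (2) every column (a_ik)_k has at most one entry 1 and at most one entry -1,
-- all others being 0, so it is an oriented edge of a graph on the equations
-- together with one extra ground vertex.  Uniqueness makes the columns linearly
-- independent, so removing the edge i disconnects its two ends.  Let A be the
-- component of an end that is separated from the ground.  Every edge but i
-- contributes 0 to the sum of the equations over A, which therefore reads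
-- ± x_i + Σ_j (Σ_{k ∈ A} b_jk) v_j = 0, and (2) bounds its coefficients.
module Submission where

open import Defs
open import Algebra.Bundles using (CommutativeMonoid)
open import Algebra.Module.Bundles using (Module)
import Algebra.Properties.AbelianGroup as AbelianGroupProperties
import Algebra.Properties.CommutativeMonoid.Sum as CommutativeMonoidSum
import Algebra.Properties.CommutativeSemigroup as CommutativeSemigroupProperties
import Algebra.Properties.Ring as RingProperties
import Algebra.Properties.Semiring.Sum as SemiringSum
open import Data.Bool.Base using (true; false; if_then_else_)
open import Data.Empty using (⊥-elim)
open import Data.Fin.Base using (Fin; zero; suc; punchIn; punchOut)
open import Data.Fin.Properties using (_≟_; punchIn-punchOut; punchInᵢ≢i)
open import Data.Fin.Subset using (Subset; ⊥; ⁅_⁆)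
open import Data.Maybe.Base using (Maybe; just; nothing; map)
import Data.Maybe.Properties as Maybe
open import Data.Nat.Base using (ℕ; suc) renaming (_*_ to _*ℕ_)
import Data.Nat.Properties as ℕ
open import Data.Nat.Primality using (Prime)
open import Data.Product using (∃!; ∃-syntax; Σ-syntax; _×_; _,_; proj₁; proj₂)
open import Data.Rational.Base as ℚ using (½; ∣_∣)
import Data.Rational.Properties as ℚ
import Data.Rational.Solver as ℚSolver
open import Data.Sum.Base using (_⊎_; inj₁; inj₂)
open import Data.Vec.Base using ([]; _∷_; lookup; tabulate)
open import Data.Vec.Properties using (lookup∘tabulate)
open import Data.Vec.Functional using (Vector; insertAt; removeAt) renaming (_∷_ to _∷ᶠ_)
open import Data.Vec.Functional.Properties using (insertAt-lookup; insertAt-punchIn)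
open import Data.Vec.Functional.Relation.Binary.Pointwise using (Pointwise)
open import Function.Base using (_∘_)
open import Relation.Binary.Definitions using (DecidableEquality)
open import Relation.Binary.PropositionalEquality using (_≡_; _≢_; refl; sym; trans; cong; subst)
import Relation.Binary.Reasoning.Setoid as SetoidReasoning
open import Relation.Nullary.Decidable using (yes; no; does; dec-true; dec-false; toWitnessFalse)
open import Relation.Nullary.Negation using (¬_)

-- Reals equal to -1, 0 or 1, and sums over subsets

private
  module ℝP = RingProperties ℝR.ring
  module ℝΣ* = SemiringSum ℝR.semiring
  module ℚS = ℚSolver.+-*-Solver

-- Equality yields closeness from some index on, so it is refuted at that index. The uses below
-- compare distinct integer constants, which differ by at least 1; there the rational comparison
-- with ½ is decided by evaluation.
apart⇒≉ : ∀ {x y} → (∀ n → ¬ (∣ seq x n ℚ.- seq y n ∣ ℚ.< ½)) → ¬ x ≈ y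
apart⇒≉ apart x≈y with close x≈y ½ (ℚ.positive⁻¹ ½)
... | N , f = apart N (f N ℕ.≤-refl)

0≉1 : ¬ 0ℝ ≈ 1ℝ
0≉1 = apart⇒≉ λ _ → toWitnessFalse {a? = _ ℚ.<? _} _

2∉[-1,0,1] : ¬ ∈[-1,0,1] (1ℝ + 1ℝ)
2∉[-1,0,1] (inj₁ eq)        = apart⇒≉ (λ _ → toWitnessFalse {a? = _ ℚ.<? _} _) eq
2∉[-1,0,1] (inj₂ (inj₁ eq)) = apart⇒≉ (λ _ → toWitnessFalse {a? = _ ℚ.<? _} _) eq
2∉[-1,0,1] (inj₂ (inj₂ eq)) = apart⇒≉ (λ _ → toWitnessFalse {a? = _ ℚ.<? _} _) eq

∈[-1,0,1]-resp-≈ : ∀ {x y} → x ≈ y → ∈[-1,0,1] x → ∈[-1,0,1] y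
∈[-1,0,1]-resp-≈ x≈y (inj₁ eq)        = inj₁ (ℝR.trans (ℝR.sym x≈y) eq)
∈[-1,0,1]-resp-≈ x≈y (inj₂ (inj₁ eq)) = inj₂ (inj₁ (ℝR.trans (ℝR.sym x≈y) eq))
∈[-1,0,1]-resp-≈ x≈y (inj₂ (inj₂ eq)) = inj₂ (inj₂ (ℝR.trans (ℝR.sym x≈y) eq))

∈[-1,0,1]-neg : ∀ {x} → ∈[-1,0,1] x → ∈[-1,0,1] (- x)
∈[-1,0,1]-neg (inj₁ eq)        = inj₂ (inj₂ (ℝR.trans (ℝR.-‿cong eq) (ℝP.-‿involutive 1ℝ)))
∈[-1,0,1]-neg (inj₂ (inj₁ eq)) = inj₂ (inj₁ (ℝR.trans (ℝR.-‿cong eq) ℝP.-0#≈0#))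
∈[-1,0,1]-neg (inj₂ (inj₂ eq)) = inj₁ (ℝR.-‿cong eq)

sum-zero : ∀ {n} {f : Vector ℝ n} → (∀ i → f i ≈ 0ℝ) → ℝΣ.sum f ≈ 0ℝ
sum-zero {n} f≈0 = ℝR.trans (ℝΣ.sum-cong-≋ f≈0) (ℝΣ.sum-replicate-zero n)

sumOver-cong : ∀ {n} (A : Subset n) {r s : Vector ℝ n} → (∀ k → r k ≈ s k) → sumOver A r ≈ sumOver A s
sumOver-cong []          r≈s = ℝR.refl
sumOver-cong (true  ∷ A) r≈s = ℝR.+-cong (r≈s zero) (sumOver-cong A (r≈s ∘ suc))
sumOver-cong (false ∷ A) r≈s = ℝR.+-congˡ (sumOver-cong A (r≈s ∘ suc))

sumOver-⊥ : ∀ {n} (r : Vector ℝ n) → sumOver ⊥ r ≈ 0ℝ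
sumOver-⊥ {ℕ.zero} r = ℝR.refl
sumOver-⊥ {suc n}  r = ℝR.trans (ℝR.+-identityˡ _) (sumOver-⊥ (r ∘ suc))

sumOver-⁅⁆ : ∀ {n} (k : Fin n) (r : Vector ℝ n) → sumOver ⁅ k ⁆ r ≈ r k
sumOver-⁅⁆ zero    r = ℝR.trans (ℝR.+-congˡ (sumOver-⊥ (r ∘ suc))) (ℝR.+-identityʳ _)
sumOver-⁅⁆ (suc k) r = ℝR.trans (ℝR.+-identityˡ _) (sumOver-⁅⁆ k (r ∘ suc))

-- Vertices, edge vectors and subset indicators

-- Vertices are the equations and, as nothing, the ground vertex, whose unit
-- vector is 0.
Vertex : ℕ → Set
Vertex L = Maybe (Fin L)

_≟ᵛ_ : ∀ {L} → DecidableEquality (Vertex L)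
_≟ᵛ_ = Maybe.≡-dec _≟_

unit : ∀ {L} → Vertex L → Vector ℝ L
unit nothing        _       = 0ℝ
unit (just zero)    zero    = 1ℝ
unit (just zero)    (suc k) = 0ℝ
unit (just (suc j)) zero    = 0ℝ
unit (just (suc j)) (suc k) = unit (just j) k

-- A column of an oriented incidence matrix with the row of the ground vertex deleted. An edge at
-- the ground has a single nonzero entry, and a loop is the zero column.
edge : ∀ {L} → Vertex L → Vertex L → Vector ℝ L
edge s t k = unit s k - unit t k

indicator : ∀ {L} → Subset L → Vertex L → ℝ
indicator A nothing  = 0ℝ
indicator A (just k) = if lookup A k then 1ℝ else 0ℝ

sumOver-zero : ∀ {n} (A : Subset n) → sumOver A (λ _ → 0ℝ) ≈ 0ℝ
sumOver-zero []          = ℝR.refl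
sumOver-zero (true  ∷ A) = ℝR.trans (ℝR.+-identityˡ _) (sumOver-zero A)
sumOver-zero (false ∷ A) = ℝR.trans (ℝR.+-identityˡ _) (sumOver-zero A)

sumOver-unit : ∀ {L} (A : Subset L) (s : Vertex L) → sumOver A (unit s) ≈ indicator A s
sumOver-unit A           nothing        = sumOver-zero A
sumOver-unit (true  ∷ A) (just zero)    = ℝR.trans (ℝR.+-congˡ (sumOver-zero A)) (ℝR.+-identityʳ _)
sumOver-unit (false ∷ A) (just zero)    = ℝR.trans (ℝR.+-congˡ (sumOver-zero A)) (ℝR.+-identityʳ _)
sumOver-unit (true  ∷ A) (just (suc j)) = ℝR.trans (ℝR.+-identityˡ _) (sumOver-unit A (just j))
sumOver-unit (false ∷ A) (just (suc j)) = ℝR.trans (ℝR.+-identityˡ _) (sumOver-unit A (just j))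

sumOver-difference : ∀ {n} (A : Subset n) (r s : Vector ℝ n) →
                     sumOver A (λ k → r k - s k) ≈ sumOver A r - sumOver A s
sumOver-difference []      r s = ℝR.sym (ℝR.-‿inverseʳ 0ℝ)
sumOver-difference (c ∷ A) r s = ℝR.trans (ℝR.+-cong (head c) (sumOver-difference A (r ∘ suc) (s ∘ suc)))
    (interchange (if c then r zero else 0ℝ) (if c then s zero else 0ℝ)
                 (sumOver A (r ∘ suc)) (sumOver A (s ∘ suc)))
  where
  head : ∀ c → (if c then r zero - s zero else 0ℝ) ≈ (if c then r zero else 0ℝ) - (if c then s zero else 0ℝ)
  head true  = ℝR.refl
  head false = ℝR.sym (ℝR.-‿inverseʳ 0ℝ)
  interchange : ∀ x y z w → (x - y) + (z - w) ≈ (x + z) - (y + w)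
  interchange x y z w = pointwise⇒≈ λ n → ℚS.solve 4 (λ x y z w →
    (x ℚS.:- y) ℚS.:+ (z ℚS.:- w) ℚS.:= (x ℚS.:+ z) ℚS.:- (y ℚS.:+ w)) refl
    (seq x n) (seq y n) (seq z n) (seq w n)

-- The coboundary formula: the sum vanishes when both ends lie on the same side of `A` and is 1 or
-- -1 when the edge leaves or enters `A`, the ground counting as outside.
sumOver-edge : ∀ {L} (A : Subset L) (s t : Vertex L) →
               sumOver A (edge s t) ≈ indicator A s - indicator A t
sumOver-edge A s t = ℝR.trans (sumOver-difference A (unit s) (unit t))
  (ℝR.+-cong (sumOver-unit A s) (ℝR.-‿cong (sumOver-unit A t)))

-- Columns of the system as oriented edges

-- The last two fields exclude the degenerate presentations s ≡ t ≡ just k of the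
-- zero vector.
record IsEdge {L} (u : Vector ℝ L) : Set where
  field
    source target : Vertex L
    u≈edge        : ∀ k → u k ≈ edge source target k
    u-source      : ∀ k → source ≡ just k → u k ≈ 1ℝ
    u-target      : ∀ k → target ≡ just k → u k ≈ - 1ℝ

SumsIn[-1,0,1] : ∀ {L} → Vector ℝ L → Set
SumsIn[-1,0,1] u = ∀ A → ∈[-1,0,1] (sumOver A u)

module _ {L} (u : Vector ℝ (suc L)) (sums : SumsIn[-1,0,1] u) where

  sumsIn-tail : SumsIn[-1,0,1] (u ∘ suc)
  sumsIn-tail A = ∈[-1,0,1]-resp-≈ (ℝR.+-identityˡ _) (sums (false ∷ A))

  -- This instance forbids two entries of the same nonzero sign, whose sum would be 2 or -2.
  sumsIn-pair : ∀ k → ∈[-1,0,1] (u zero + u (suc k))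
  sumsIn-pair k = ∈[-1,0,1]-resp-≈ (ℝR.+-congˡ (sumOver-⁅⁆ k (u ∘ suc))) (sums (true ∷ ⁅ k ⁆))

  sumsIn-head : ∈[-1,0,1] (u zero)
  sumsIn-head = ∈[-1,0,1]-resp-≈ (sumOver-⁅⁆ zero u) (sums ⁅ zero ⁆)

unit-map-suc-zero : ∀ {L} (s : Vertex L) → unit (map suc s) zero ≈ 0ℝ
unit-map-suc-zero nothing  = ℝR.refl
unit-map-suc-zero (just _) = ℝR.refl

unit-map-suc-suc : ∀ {L} (s : Vertex L) k → unit (map suc s) (suc k) ≈ unit s k
unit-map-suc-suc nothing  k = ℝR.refl
unit-map-suc-suc (just _) k = ℝR.refl

map-suc≢zero : ∀ {L} (s : Vertex L) → map suc s ≢ just zero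
map-suc≢zero nothing  ()
map-suc≢zero (just _) ()

map-suc-injective : ∀ {L} (s : Vertex L) {k} → map suc s ≡ just (suc k) → s ≡ just k
map-suc-injective (just _) refl = refl

-- Induction on the length. The tail is an edge already; a head entry 1 or -1 becomes the source or
-- target, provided that end of the tail was still at the ground. If it was not, `sumsIn-pair` is
-- violated.
isEdge : ∀ {L} (u : Vector ℝ L) → SumsIn[-1,0,1] u → IsEdge u
isEdge {ℕ.zero} u sums = record
  { source = nothing ; target = nothing ; u≈edge = λ () ; u-source = λ () ; u-target = λ () }
isEdge {suc L} u sums = extend (isEdge (u ∘ suc) (sumsIn-tail u sums)) (sumsIn-head u sums)
  where
  extend : IsEdge (u ∘ suc) → ∈[-1,0,1] (u zero) → IsEdge u
  -- `map suc` renumbers the equations of the tail and keeps the ground fixed.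
  extend e (inj₂ (inj₁ u₀≈0)) = record
    { source = map suc source
    ; target = map suc target
    ; u≈edge = λ where
        zero    → ℝR.trans u₀≈0 (ℝR.sym (ℝR.trans
                    (ℝR.+-cong (unit-map-suc-zero source) (ℝR.-‿cong (unit-map-suc-zero target)))
                    (ℝR.-‿inverseʳ 0ℝ)))
        (suc k) → ℝR.trans (u≈edge k) (ℝR.sym
                    (ℝR.+-cong (unit-map-suc-suc source k) (ℝR.-‿cong (unit-map-suc-suc target k))))
    ; u-source = λ where
        zero    eq → ⊥-elim (map-suc≢zero source eq)
        (suc k) eq → u-source k (map-suc-injective source eq)
    ; u-target = λ where
        zero    eq → ⊥-elim (map-suc≢zero target eq)
        (suc k) eq → u-target k (map-suc-injective target eq)
    }
    where open IsEdge e
  extend record { source = just k ; u-source = u-source } (inj₂ (inj₂ u₀≈1)) =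
    ⊥-elim (2∉[-1,0,1] (∈[-1,0,1]-resp-≈ (ℝR.+-cong u₀≈1 (u-source k refl)) (sumsIn-pair u sums k)))
  extend record { source = nothing ; target = t ; u≈edge = u≈edge ; u-target = u-target } (inj₂ (inj₂ u₀≈1)) = record
    { source = just zero
    ; target = map suc t
    ; u≈edge = λ where
        zero    → ℝR.trans u₀≈1 (ℝR.sym (ℝR.trans
                    (ℝR.+-congˡ (ℝR.-‿cong (unit-map-suc-zero t))) 1-0≈1))
        (suc k) → ℝR.trans (u≈edge k) (ℝR.sym (ℝR.+-congˡ (ℝR.-‿cong (unit-map-suc-suc t k))))
    ; u-source = λ { zero eq → u₀≈1 ; (suc k) () }
    ; u-target = λ where
        zero    eq → ⊥-elim (map-suc≢zero t eq)
        (suc k) eq → u-target k (map-suc-injective t eq)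
    }
    where
    1-0≈1 : 1ℝ - 0ℝ ≈ 1ℝ
    1-0≈1 = pointwise⇒≈ λ _ → refl
  extend record { target = just k ; u-target = u-target } (inj₁ u₀≈-1) =
    -- The two entries sum to -2; negating reduces this to the exclusion of 2.
    ⊥-elim (2∉[-1,0,1] (∈[-1,0,1]-resp-≈ (pointwise⇒≈ λ _ → refl)
      (∈[-1,0,1]-neg (∈[-1,0,1]-resp-≈ (ℝR.+-cong u₀≈-1 (u-target k refl)) (sumsIn-pair u sums k)))))
  extend record { source = s ; target = nothing ; u≈edge = u≈edge ; u-source = u-source } (inj₁ u₀≈-1) = record
    { source = map suc s
    ; target = just zero
    ; u≈edge = λ where
        zero    → ℝR.trans u₀≈-1 (ℝR.sym (ℝR.trans
                    (ℝR.+-congʳ (unit-map-suc-zero s)) (ℝR.+-identityˡ (- 1ℝ))))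
        (suc k) → ℝR.trans (u≈edge k) (ℝR.sym (ℝR.+-congʳ (unit-map-suc-suc s k)))
    ; u-source = λ where
        zero    eq → ⊥-elim (map-suc≢zero s eq)
        (suc k) eq → u-source k (map-suc-injective s eq)
    ; u-target = λ { zero eq → u₀≈-1 ; (suc k) () }
    }

-- Connectedness and components

-- An algebraic stand-in for a path from `u` to `w`: a path gives such coefficients by counting its
-- edges with sign, and this is the form that linear independence can contradict.
record InSpan {L M} (s t : Fin M → Vertex L) (u w : Vertex L) : Set where
  constructor _,_
  field
    coefficients : Vector ℝ M
    spans        : ∀ k → edge u w k ≈ ℝΣ.sum λ i → coefficients i * edge (s i) (t i) k

module _ {L M} {s t : Fin M → Vertex L} where

  inSpan-refl : ∀ u → InSpan s t u u
  inSpan-refl u = (λ _ → 0ℝ) , λ k → ℝR.trans (ℝR.-‿inverseʳ (unit u k))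
    (ℝR.sym (sum-zero λ i → ℝR.zeroˡ (edge (s i) (t i) k)))

  inSpan-sym : ∀ {u w} → InSpan s t u w → InSpan s t w u
  inSpan-sym {u} {w} (r , eq) = (λ i → - 1ℝ * r i) , λ k → begin
    edge w u k                                               ≈⟨ flip (unit w k) (unit u k) ⟩
    - 1ℝ * edge u w k                                        ≈⟨ ℝR.*-congˡ (eq k) ⟩
    - 1ℝ * ℝΣ.sum (λ i → r i * edge (s i) (t i) k)           ≈⟨ ℝΣ*.*-distribˡ-sum (- 1ℝ) (λ i → r i * edge (s i) (t i) k) ⟩
    ℝΣ.sum (λ i → - 1ℝ * (r i * edge (s i) (t i) k))         ≈⟨ ℝΣ.sum-cong-≋ (λ i → ℝR.sym (ℝR.*-assoc (- 1ℝ) (r i) (edge (s i) (t i) k))) ⟩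
    ℝΣ.sum (λ i → - 1ℝ * r i * edge (s i) (t i) k)           ∎
    where
    open SetoidReasoning ℝR.setoid
    flip : ∀ x y → x - y ≈ - 1ℝ * (y - x)
    flip x y = ℝR.sym (ℝR.trans (ℝP.-1*x≈-x (y - x)) (pointwise⇒≈ λ n →
      ℚS.solve 2 (λ x y → ℚS.:- (y ℚS.:- x) ℚS.:= x ℚS.:- y) refl (seq x n) (seq y n)))

  inSpan-trans : ∀ {u w z} → InSpan s t u w → InSpan s t w z → InSpan s t u z
  inSpan-trans {u} {w} {z} (r , eq) (r′ , eq′) = (λ i → r i + r′ i) , λ k → begin
    edge u z k                                                        ≈⟨ telescope (unit u k) (unit w k) (unit z k) ⟩
    edge u w k + edge w z k                                           ≈⟨ ℝR.+-cong (eq k) (eq′ k) ⟩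
    ℝΣ.sum (λ i → r i * e i k) + ℝΣ.sum (λ i → r′ i * e i k)          ≈⟨ ℝΣ.∑-distrib-+ (λ i → r i * e i k) (λ i → r′ i * e i k) ⟨
    ℝΣ.sum (λ i → r i * e i k + r′ i * e i k)                         ≈⟨ ℝΣ.sum-cong-≋ (λ i → ℝR.sym (ℝR.distribʳ (e i k) (r i) (r′ i))) ⟩
    ℝΣ.sum (λ i → (r i + r′ i) * e i k)                               ∎
    where
    open SetoidReasoning ℝR.setoid
    e : Fin M → Vector ℝ L
    e i = edge (s i) (t i)
    telescope : ∀ x y z → x - z ≈ (x - y) + (y - z)
    telescope x y z = pointwise⇒≈ λ n →
      ℚS.solve 3 (λ x y z → x ℚS.:- z ℚS.:= (x ℚS.:- y) ℚS.:+ (y ℚS.:- z)) refl (seq x n) (seq y n) (seq z n)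

module _ {L M} {s t : Fin (suc M) → Vertex L} where

  inSpan-weaken : ∀ {u w} → InSpan (s ∘ suc) (t ∘ suc) u w → InSpan s t u w
  inSpan-weaken (r , eq) = 0ℝ ∷ᶠ r , λ k → ℝR.trans (eq k)
    (ℝR.sym (ℝR.trans (ℝR.+-congʳ (ℝR.zeroˡ (edge (s zero) (t zero) k))) (ℝR.+-identityˡ _)))

  inSpan-edge : InSpan s t (s zero) (t zero)
  inSpan-edge = 1ℝ ∷ᶠ (λ _ → 0ℝ) , λ k → ℝR.sym (ℝR.trans
    (ℝR.+-cong (ℝR.*-identityˡ _) (sum-zero λ i → ℝR.zeroˡ (edge (s (suc i)) (t (suc i)) k)))
    (ℝR.+-identityʳ _))

module _ {L} (x y : Vertex L) where

  -- The union step of union-find, acting on labels.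
  redirect : Vertex L → Vertex L
  redirect z = if does (z ≟ᵛ x) then y else z

  redirect-merges : redirect x ≡ redirect y
  redirect-merges with y ≟ᵛ x
  ... | yes refl rewrite dec-true (x ≟ᵛ x) refl = refl
  ... | no  _    rewrite dec-true (x ≟ᵛ x) refl = refl

  -- The cases say how two vertices with these labels become connected by a new edge joining the
  -- classes `x` and `y`: they were connected before, or the edge is crossed in one of its two
  -- directions.
  redirect-fibres : ∀ z w → redirect z ≡ redirect w →
                    z ≡ w ⊎ (z ≡ x × w ≡ y) ⊎ (z ≡ y × w ≡ x)
  redirect-fibres z w eq with z ≟ᵛ x | w ≟ᵛ x
  ... | yes z≡x | yes w≡x = inj₁ (trans z≡x (sym w≡x))
  ... | yes z≡x | no  _   = inj₂ (inj₁ (z≡x , sym eq))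
  ... | no  _   | yes w≡x = inj₂ (inj₂ (eq , w≡x))
  ... | no  _   | no  _   = inj₁ eq

-- `label-edge` makes the label classes at least as coarse as the connected components;
-- `label-inSpan` prevents them from joining vertices that the edges do not connect.
record Components {L M} (s t : Fin M → Vertex L) : Set where
  field
    label         : Vertex L → Vertex L
    label-edge    : ∀ i → label (s i) ≡ label (t i)
    label-inSpan  : ∀ u w → label u ≡ label w → InSpan s t u w

-- Edges are inserted one at a time. Without edges every vertex is its own label; a new edge merges
-- the labels of its two ends.
components : ∀ {L M} (s t : Fin M → Vertex L) → Components s t
components {M = ℕ.zero} s t = record
  { label        = λ u → u
  ; label-edge   = λ ()
  ; label-inSpan = λ { u .u refl → inSpan-refl u }
  }
components {L} {suc M} s t = record
  { label      = merge ∘ label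
  ; label-edge = λ { zero → redirect-merges x y ; (suc i) → cong merge (label-edge i) }
  ; label-inSpan = λ u w eq → connect u w (redirect-fibres x y (label u) (label w) eq)
  }
  where
  open Components (components (s ∘ suc) (t ∘ suc))
  x = label (s zero)
  y = label (t zero)
  merge = redirect x y
  old : ∀ u w → label u ≡ label w → InSpan s t u w
  old u w eq = inSpan-weaken (label-inSpan u w eq)
  connect : ∀ u w → label u ≡ label w ⊎ (label u ≡ x × label w ≡ y) ⊎ (label u ≡ y × label w ≡ x) →
            InSpan s t u w
  connect u w (inj₁ eq) = old u w eq
  connect u w (inj₂ (inj₁ (u≡x , w≡y))) =
    inSpan-trans (old u (s zero) u≡x) (inSpan-trans inSpan-edge (old (t zero) w (sym w≡y)))
  connect u w (inj₂ (inj₂ (u≡y , w≡x))) =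
    inSpan-trans (old u (t zero) u≡y) (inSpan-trans (inSpan-sym inSpan-edge) (old (s zero) w (sym w≡x)))

-- Label classes as sets of equations

module _ {L} (φ : Vertex L → Vertex L) (ℓ : Vertex L) where

  fibre : Subset L
  fibre = tabulate λ k → does (φ (just k) ≟ᵛ ℓ)

  -- A `Subset` cannot contain the ground vertex, and `indicator` is 0 there. The hypothesis keeps
  -- the ground out of the class of `ℓ`, so the formula is right at `nothing` too.
  indicator-fibre : ℓ ≢ φ nothing → ∀ u → indicator fibre u ≡ (if does (φ u ≟ᵛ ℓ) then 1ℝ else 0ℝ)
  indicator-fibre ℓ≢ nothing
    rewrite dec-false (φ nothing ≟ᵛ ℓ) (ℓ≢ ∘ sym) = refl
  indicator-fibre ℓ≢ (just k)
    rewrite lookup∘tabulate (λ k → does (φ (just k) ≟ᵛ ℓ)) k = refl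

  module _ (ℓ≢ : ℓ ≢ φ nothing) where

    indicator-inside : ∀ {u} → φ u ≡ ℓ → indicator fibre u ≡ 1ℝ
    indicator-inside {u} eq = trans (indicator-fibre ℓ≢ u)
      (cong (λ c → if c then 1ℝ else 0ℝ) (dec-true (φ u ≟ᵛ ℓ) eq))

    indicator-outside : ∀ {u} → φ u ≢ ℓ → indicator fibre u ≡ 0ℝ
    indicator-outside {u} neq = trans (indicator-fibre ℓ≢ u)
      (cong (λ c → if c then 1ℝ else 0ℝ) (dec-false (φ u ≟ᵛ ℓ) neq))

    indicator-constant : ∀ {u w} → φ u ≡ φ w → indicator fibre u ≡ indicator fibre w
    indicator-constant {u} {w} eq = trans (indicator-fibre ℓ≢ u)
      (trans (cong (λ z → if does (z ≟ᵛ ℓ) then 1ℝ else 0ℝ) eq) (sym (indicator-fibre ℓ≢ w)))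

-- Cuts from linear independence

LinearlyIndependent : ∀ {N L} → (Fin N → Vector ℝ L) → Set
LinearlyIndependent {N} a = ∀ (r : Vector ℝ N) → (∀ k → ℝΣ.sum (λ i → r i * a i k) ≈ 0ℝ) → ∀ i → r i ≈ 0ℝ

-- Adding up the equations in `side` eliminates all variables but the one with index `i`. If the
-- columns are edges, this is a fundamental cut: only the edge `i` crosses it.
record Cut {N L} (a : Fin N → Vector ℝ L) (i : Fin N) : Set where
  field
    side     : Subset L
    others   : ∀ j → j ≢ i → sumOver side (a j) ≈ 0ℝ
    selected : sumOver side (a i) ≈ 1ℝ ⊎ sumOver side (a i) ≈ - 1ℝ

module _ {n L} (a : Fin (suc n) → Vector ℝ L) (edges : ∀ i → IsEdge (a i))
         (independent : LinearlyIndependent a) (i : Fin (suc n)) where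

  private
    s t : Fin (suc n) → Vertex L
    s j = IsEdge.source (edges j)
    t j = IsEdge.target (edges j)

    open Components (components (removeAt s i) (removeAt t i))

    -- If the other edges combined to edge `i`, giving `i` the coefficient -1 would yield a linear
    -- relation among all columns, and independence would force -1 to be 0.
    not-inSpan : ¬ InSpan (removeAt s i) (removeAt t i) (s i) (t i)
    not-inSpan (r , eq) = 0≉1 (ℝR.sym (ℝR.trans (ℝR.sym (ℝP.-‿involutive 1ℝ))
        (ℝR.trans (ℝR.-‿cong -1≈0) ℝP.-0#≈0#)))
      where
      open SetoidReasoning ℝR.setoid
      r′ : Vector ℝ (suc n)
      r′ = insertAt r i (- 1ℝ)
      kernel : ∀ k → ℝΣ.sum (λ j → r′ j * a j k) ≈ 0ℝ
      kernel k = begin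
        ℝΣ.sum (λ j → r′ j * a j k)
          ≈⟨ ℝΣ.sum-remove {i = i} (λ j → r′ j * a j k) ⟩
        r′ i * a i k + ℝΣ.sum (λ j → r′ (punchIn i j) * a (punchIn i j) k)
          ≈⟨ ℝR.+-cong
               (ℝR.*-cong (ℝR.reflexive (insertAt-lookup r i (- 1ℝ))) (IsEdge.u≈edge (edges i) k))
               (ℝΣ.sum-cong-≋ λ j → ℝR.*-cong (ℝR.reflexive (insertAt-punchIn r i (- 1ℝ) j))
                                              (IsEdge.u≈edge (edges (punchIn i j)) k)) ⟩
        - 1ℝ * edge (s i) (t i) k + ℝΣ.sum (λ j → r j * edge (removeAt s i j) (removeAt t i j) k)
          ≈⟨ ℝR.+-cong (ℝP.-1*x≈-x _) (ℝR.sym (eq k)) ⟩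
        - edge (s i) (t i) k + edge (s i) (t i) k
          ≈⟨ ℝR.-‿inverseˡ _ ⟩
        0ℝ ∎
      -1≈0 : - 1ℝ ≈ 0ℝ
      -1≈0 = ℝR.trans (ℝR.reflexive (sym (insertAt-lookup r i (- 1ℝ)))) (independent r′ kernel i)

    separated : label (s i) ≢ label (t i)
    separated eq = not-inSpan (label-inSpan (s i) (t i) eq)

    sum-column : ∀ A j → sumOver A (a j) ≈ indicator A (s j) - indicator A (t j)
    sum-column A j = ℝR.trans (sumOver-cong A (IsEdge.u≈edge (edges j))) (sumOver-edge A (s j) (t j))

    module _ {ℓ} (ℓ≢ : ℓ ≢ label nothing) where

      otherSums : ∀ j → j ≢ i → sumOver (fibre label ℓ) (a j) ≈ 0ℝ
      otherSums j j≢i = ℝR.trans (sum-column A j) (ℝR.trans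
          (ℝR.+-congʳ (ℝR.reflexive (indicator-constant label ℓ ℓ≢ {s j} {t j} same)))
          (ℝR.-‿inverseʳ _))
        where
        A = fibre label ℓ
        same : label (s j) ≡ label (t j)
        -- As `j` differs from `i`, it is still an edge after the deletion of `i`, with index
        -- `punchOut`.
        same = subst (λ j → label (s j) ≡ label (t j)) (punchIn-punchOut (j≢i ∘ sym))
                     (label-edge (punchOut (j≢i ∘ sym)))

  -- The ends of edge `i` carry different labels, so at least one label differs from that of the
  -- ground, and its class serves as `side`. The sum is 1 if that end is the source and -1 if it is
  -- the target.
  cut : Cut a i
  cut with label (s i) ≟ᵛ label nothing
  ... | no ℓ≢ = record
    { side     = fibre label (label (s i))
    ; others   = otherSums ℓ≢
    ; selected = inj₁ (ℝR.trans (sum-column _ i) (ℝR.trans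
        (ℝR.+-cong (ℝR.reflexive (indicator-inside label _ ℓ≢ {s i} refl))
                   (ℝR.-‿cong (ℝR.reflexive (indicator-outside label _ ℓ≢ {t i} (separated ∘ sym)))))
        (pointwise⇒≈ λ _ → refl)))
    }
  ... | yes ℓ≡ = record
    { side     = fibre label (label (t i))
    ; others   = otherSums ℓ≢
    ; selected = inj₂ (ℝR.trans (sum-column _ i) (ℝR.trans
        (ℝR.+-cong (ℝR.reflexive (indicator-outside label _ ℓ≢ {s i} separated))
                   (ℝR.-‿cong (ℝR.reflexive (indicator-inside label _ ℓ≢ {t i} refl))))
        (ℝR.+-identityˡ _)))
    }
    where
    ℓ≢ : label (t i) ≢ label nothing
    ℓ≢ eq = separated (trans ℓ≡ (sym eq))

-- Linear systems in a real vector space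

module _ {m ℓm} (W : Module ℝ-commutativeRing m ℓm) where
  open Module W
  open Linear W
  private
    module ∑ = CommutativeMonoidSum +ᴹ-commutativeMonoid
    module G = AbelianGroupProperties +ᴹ-abelianGroup
  open CommutativeSemigroupProperties (CommutativeMonoid.commutativeSemigroup +ᴹ-commutativeMonoid)
    using (interchange)
  open SetoidReasoning ≈ᴹ-setoid

  linComb-zero : ∀ {n} {r : Vector ℝ n} (x : Vector Carrierᴹ n) → (∀ i → r i ≈ 0ℝ) → linComb r x ≈ᴹ 0ᴹ
  linComb-zero {n} x r≈0 = ≈ᴹ-trans
    (∑.sum-cong-≋ λ i → ≈ᴹ-trans (*ₗ-congʳ (r≈0 i)) (*ₗ-zeroˡ (x i))) (∑.sum-replicate-zero n)

  linComb-distrib-+ : ∀ {n} (r s : Vector ℝ n) (x : Vector Carrierᴹ n) →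
                      linComb (λ i → r i + s i) x ≈ᴹ linComb r x +ᴹ linComb s x
  linComb-distrib-+ r s x = ≈ᴹ-trans (∑.sum-cong-≋ λ i → *ₗ-distribʳ (x i) (r i) (s i))
    (∑.∑-distrib-+ (λ i → r i *ₗ x i) (λ i → s i *ₗ x i))

  linComb-distrib-+ᴹ : ∀ {n} (r : Vector ℝ n) (x y : Vector Carrierᴹ n) →
                       linComb r (λ i → x i +ᴹ y i) ≈ᴹ linComb r x +ᴹ linComb r y
  linComb-distrib-+ᴹ r x y = ≈ᴹ-trans (∑.sum-cong-≋ λ i → *ₗ-distribˡ (r i) (x i) (y i))
    (∑.∑-distrib-+ (λ i → r i *ₗ x i) (λ i → r i *ₗ y i))

  -- Transfers a scalar relation among columns to a tuple of multiples of one vector.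
  linComb-multiples : ∀ {n} (r s : Vector ℝ n) w →
                      linComb r (λ i → s i *ₗ w) ≈ᴹ ℝΣ.sum (λ i → s i * r i) *ₗ w
  linComb-multiples {ℕ.zero} r s w = ≈ᴹ-sym (*ₗ-zeroˡ w)
  linComb-multiples {suc n}  r s w = ≈ᴹ-sym (≈ᴹ-trans (*ₗ-distribʳ w _ _)
    (+ᴹ-cong (≈ᴹ-trans (*ₗ-congʳ (ℝR.*-comm (s zero) (r zero))) (*ₗ-assoc (r zero) (s zero) w))
             (≈ᴹ-sym (linComb-multiples (r ∘ suc) (s ∘ suc) w))))

  linComb-single : ∀ {n} {r : Vector ℝ n} (x : Vector Carrierᴹ n) i → (∀ j → j ≢ i → r j ≈ 0ℝ) →
                   linComb r x ≈ᴹ r i *ₗ x i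
  linComb-single {suc n} {r} x i r≈0 = ≈ᴹ-trans (∑.sum-remove {i = i} (λ j → r j *ₗ x j))
    (≈ᴹ-trans (+ᴹ-congˡ (linComb-zero (removeAt x i) λ j → r≈0 (punchIn i j) (punchInᵢ≢i i j)))
              (+ᴹ-identityʳ _))

  -- The equations are peeled off one by one: a chosen one holds for `x`, and a dropped one has only
  -- zero coefficients.
  solves-sumOver : ∀ {N M L} (A : Subset L) (a : Fin N → Vector ℝ L) (b : Fin M → Vector ℝ L)
                   (v : Vector Carrierᴹ M) (x : Vector Carrierᴹ N) → Solves a b v x →
                   linComb (λ i → sumOver A (a i)) x +ᴹ linComb (λ j → sumOver A (b j)) v ≈ᴹ 0ᴹ
  solves-sumOver [] a b v x sol =
    ≈ᴹ-trans (+ᴹ-cong (linComb-zero x λ _ → ℝR.refl) (linComb-zero v λ _ → ℝR.refl)) (+ᴹ-identityˡ 0ᴹ)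
  solves-sumOver (c ∷ A) a b v x sol = begin
    linComb (λ i → pick c (a i zero) + a′ i) x +ᴹ linComb (λ j → pick c (b j zero) + b′ j) v
      ≈⟨ +ᴹ-cong (linComb-distrib-+ (λ i → pick c (a i zero)) a′ x)
                 (linComb-distrib-+ (λ j → pick c (b j zero)) b′ v) ⟩
    (linComb (λ i → pick c (a i zero)) x +ᴹ linComb a′ x) +ᴹ (linComb (λ j → pick c (b j zero)) v +ᴹ linComb b′ v)
      ≈⟨ interchange _ _ _ _ ⟩
    (linComb (λ i → pick c (a i zero)) x +ᴹ linComb (λ j → pick c (b j zero)) v) +ᴹ (linComb a′ x +ᴹ linComb b′ v)
      ≈⟨ +ᴹ-cong (first c) (solves-sumOver A (λ i → a i ∘ suc) (λ j → b j ∘ suc) v x (sol ∘ suc)) ⟩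
    0ᴹ +ᴹ 0ᴹ
      ≈⟨ +ᴹ-identityˡ 0ᴹ ⟩
    0ᴹ ∎
    where
    pick = λ c (r : ℝ) → if c then r else 0ℝ
    a′ = λ i → sumOver A (a i ∘ suc)
    b′ = λ j → sumOver A (b j ∘ suc)
    first : ∀ c → linComb (λ i → pick c (a i zero)) x +ᴹ linComb (λ j → pick c (b j zero)) v ≈ᴹ 0ᴹ
    first true  = sol zero
    first false = ≈ᴹ-trans (+ᴹ-cong (linComb-zero x λ _ → ℝR.refl) (linComb-zero v λ _ → ℝR.refl)) (+ᴹ-identityˡ 0ᴹ)

  -- Independence is applied to the coefficients with `r` at place `j` and 0 elsewhere, so no real
  -- number has to be inverted.
  basis-torsionFree : ∀ {n} {v : Vector Carrierᴹ n} → IsBasis v → ∀ j {r} → r *ₗ v j ≈ᴹ 0ᴹ → r ≈ 0ℝ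
  basis-torsionFree {suc n} {v} basis j {r} rv≈0 =
    ℝR.trans (ℝR.reflexive (sym (insertAt-lookup _ j r))) (IsBasis.independent basis r′ r′v≈0 j)
    where
    r′ : Vector ℝ (suc n)
    r′ = insertAt (λ _ → 0ℝ) j r
    r′≈0 : ∀ i → i ≢ j → r′ i ≈ 0ℝ
    r′≈0 i i≢j = ℝR.reflexive (trans
      (cong r′ (sym (punchIn-punchOut (i≢j ∘ sym)))) (insertAt-punchIn _ j r (punchOut (i≢j ∘ sym))))
    r′v≈0 : linComb r′ v ≈ᴹ 0ᴹ
    r′v≈0 = ≈ᴹ-trans (linComb-single v j r′≈0)
      (≈ᴹ-trans (*ₗ-congʳ (ℝR.reflexive (insertAt-lookup _ j r))) rv≈0)

  -- A relation `r` among the columns turns the solution `x` into the solution with entries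
  -- `x i +ᴹ r i *ₗ v zero`. Uniqueness makes every `r i *ₗ v zero` vanish, hence every `r i`.
  uniqueSolution⇒independent :
    ∀ {N M L} (a : Fin N → Vector ℝ L) (b : Fin (suc M) → Vector ℝ L) {v : Vector Carrierᴹ (suc M)} →
    IsBasis v → ∃! (Pointwise _≈ᴹ_) (Solves a b v) → LinearlyIndependent a
  uniqueSolution⇒independent a b {v} basis (x , sol , unique) r ra≈0 i =
    basis-torsionFree basis zero (G.∙-cancelˡ (x i) _ _
      (≈ᴹ-trans (≈ᴹ-sym (unique sol′ i)) (≈ᴹ-sym (+ᴹ-identityʳ (x i)))))
    where
    sol′ : Solves a b v (λ i → x i +ᴹ r i *ₗ v zero)
    sol′ k = ≈ᴹ-trans (+ᴹ-congʳ (begin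
      linComb (λ i → a i k) (λ i → x i +ᴹ r i *ₗ v zero)
        ≈⟨ linComb-distrib-+ᴹ (λ i → a i k) x (λ i → r i *ₗ v zero) ⟩
      linComb (λ i → a i k) x +ᴹ linComb (λ i → a i k) (λ i → r i *ₗ v zero)
        ≈⟨ +ᴹ-congˡ (linComb-multiples (λ i → a i k) r (v zero)) ⟩
      linComb (λ i → a i k) x +ᴹ ℝΣ.sum (λ i → r i * a i k) *ₗ v zero
        ≈⟨ +ᴹ-congˡ (≈ᴹ-trans (*ₗ-congʳ (ra≈0 k)) (*ₗ-zeroˡ (v zero))) ⟩
      linComb (λ i → a i k) x +ᴹ 0ᴹ
        ≈⟨ +ᴹ-identityʳ _ ⟩
      linComb (λ i → a i k) x ∎)) (sol k)

  -- Adding the equations along the cut of `i` leaves one equation with `x i` alone, up to sign, and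
  -- with the subset sums `β` as coefficients of the basis.
  uniqueSolution-coefficients :
    ∀ {n M L} (a : Fin (suc n) → Vector ℝ L) (b : Fin (suc M) → Vector ℝ L) {v : Vector Carrierᴹ (suc M)} →
    IsBasis v → ∃! (Pointwise _≈ᴹ_) (Solves a b v) →
    (∀ i → SumsIn[-1,0,1] (a i)) → (∀ j → SumsIn[-1,0,1] (b j)) →
    ∀ x → Solves a b v x → ∀ i → ∃[ c ] x i ≈ᴹ linComb c v × ∀ j → ∈[-1,0,1] (c j)
  uniqueSolution-coefficients a b {v} basis unique sums-a sums-b x sol i = solve selected
    where
    open Cut (cut a (λ i → isEdge (a i) (sums-a i)) (uniqueSolution⇒independent a b basis unique) i)
    α = sumOver side (a i)
    β = λ j → sumOver side (b j)
    equation : α *ₗ x i +ᴹ linComb β v ≈ᴹ 0ᴹ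
    equation = ≈ᴹ-trans (+ᴹ-congʳ (≈ᴹ-sym (linComb-single x i others))) (solves-sumOver side a b v x sol)
    equation′ : ∀ {ε} → α ≈ ε → ε *ₗ x i +ᴹ linComb β v ≈ᴹ 0ᴹ
    equation′ α≈ε = ≈ᴹ-trans (+ᴹ-congʳ (*ₗ-congʳ (ℝR.sym α≈ε))) equation
    solve : α ≈ 1ℝ ⊎ α ≈ - 1ℝ → ∃[ c ] x i ≈ᴹ linComb c v × ∀ j → ∈[-1,0,1] (c j)
    -- The two sides are compared after adding `linComb β v`, which makes both 0.
    solve (inj₁ α≈1) = (λ j → - β j) , G.∙-cancelʳ (linComb β v) _ _ (begin
      x i +ᴹ linComb β v                     ≈⟨ +ᴹ-congʳ (*ₗ-identityˡ (x i)) ⟨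
      1ℝ *ₗ x i +ᴹ linComb β v               ≈⟨ equation′ α≈1 ⟩
      0ᴹ                                     ≈⟨ linComb-zero v (λ j → ℝR.-‿inverseˡ (β j)) ⟨
      linComb (λ j → - β j + β j) v          ≈⟨ linComb-distrib-+ (λ j → - β j) β v ⟩
      linComb (λ j → - β j) v +ᴹ linComb β v ∎) , λ j → ∈[-1,0,1]-neg (sums-b j side)
    -- Here `β` keeps its sign: adding `- 1ℝ *ₗ x i` makes both sides 0.
    solve (inj₂ α≈-1) = β , G.∙-cancelˡ (- 1ℝ *ₗ x i) _ _ (begin
      - 1ℝ *ₗ x i +ᴹ x i          ≈⟨ +ᴹ-congˡ (*ₗ-identityˡ (x i)) ⟨
      - 1ℝ *ₗ x i +ᴹ 1ℝ *ₗ x i    ≈⟨ *ₗ-distribʳ (x i) (- 1ℝ) 1ℝ ⟨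
      (- 1ℝ + 1ℝ) *ₗ x i          ≈⟨ *ₗ-congʳ (ℝR.-‿inverseˡ 1ℝ) ⟩
      0ℝ *ₗ x i                   ≈⟨ *ₗ-zeroˡ (x i) ⟩
      0ᴹ                          ≈⟨ equation′ α≈-1 ⟨
      - 1ℝ *ₗ x i +ᴹ linComb β v  ∎) , λ j → sums-b j side

-- Application to the homology of the modular curve

lemma4p5 : (p : ℕ) → Prime p → (g : ℕ) → IsGenus p g →
  let open Module (V p)
      open Linear (V p)
  in
  (v : Vector Carrierᴹ (suc (2 *ℕ g))) → IsBasis v →
  (n K : ℕ) (a : Fin (suc n) → Fin (suc K) → ℝ) (b : Fin (suc (2 *ℕ g)) → Fin (suc K) → ℝ) →
  ∃! (Pointwise _≈ᴹ_) (Solves a b v) →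
  ((A : Subset (suc K)) (i : Fin (suc n)) (j : Fin (suc (2 *ℕ g))) →
    ∈[-1,0,1] (sumOver A (a i)) × ∈[-1,0,1] (sumOver A (b j))) →
  (x : Vector Carrierᴹ (suc n)) → Solves a b v x →
  Σ[ c ∈ (Fin (suc n) → Fin (suc (2 *ℕ g)) → ℝ) ]
    ((i : Fin (suc n)) → (x i ≈ᴹ linComb (c i) v) × ((j : Fin (suc (2 *ℕ g))) → ∈[-1,0,1] (c i j)))
lemma4p5 p _ g _ v basis n K a b unique sums x sol =
    (λ i → proj₁ (solution i)) , λ i → proj₂ (solution i)
  where
  solution = uniqueSolution-coefficients (V p) a b basis unique
    -- Condition (2) concerns `i` and `j` jointly; `zero` fills the place of the other index, both
    -- index sets being nonempty.
    (λ i A → proj₁ (sums A i zero)) (λ j A → proj₂ (sums A zero j)) x sol
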